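{- A Gauss code $X$ is realizable in a closed surface of connectivity at most $1$ (i.e. the sphere or the real projective plane) if and only if it is possible to color the symbols of $X$ with two colors so that for every pair $y,z$ of symbols of $X$: the integer $|i_X(y)\cap i_X(z)|+|i_X(y)|\cdot|i_X(z)|$ is odd if and only if $y$ and $z$ are interlaced and have the same color.
   Context: A Gauss code is a cyclic sequence in which each symbol appears exactly twice. Two distinct symbols $p,q$ are interlaced if $(p,q,p,q)$ is a (cyclic) subsequence of $X$; $i_X(p)$ denotes the set of symbols interlaced with $p$. For a closed surface $S$, the connectivity is $2-\chi(S)$. $X$ is realizable in $S$ if there is a 4-regular graph $H$ embedded in $S$ with every face an open disc, whose faces can be properly 2-colored (the two faces on either side of each edge have different colors), having exactly one smooth path (the closed walk that at each vertex leaves along the edge opposite, i.e. non-consecutive in the rotation, to the one by which it arrived), such that, identifying the vertices of $H$ with the symbols of $X$, the cyclic sequence of vertices visited by this smooth path is $X$. -}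

module Defs where

open import Data.Bool using (Bool; true; false; not; if_then_else_)
open import Data.Fin using (Fin; toℕ; _<_; _≟_)
open import Data.Fin.Properties using (any?; _<?_)
open import Data.Fin.Subset using (Subset; _∩_; ∣_∣)
open import Data.Integer as ℤ using (ℤ; +_)
open import Data.Nat using (ℕ; suc; _+_; _*_; _%_)
open import Data.Nat.DivMod using (_mod_)
open import Data.Product using (Σ-syntax; ∃-syntax; ∃!; _×_; _,_; proj₁)
open import Data.Sum using (_⊎_)
open import Data.Vec using (Vec; lookup; count; tabulate)
open import Function using (_⇔_; _↔_; StrictlySurjective)
open import Function.Bundles using (Inverse)
open import Relation.Binary.Construct.Closure.Equivalence using (EqClosure)
open import Relation.Binary.PropositionalEquality using (_≡_; _≢_)
open import Relation.Nullary using (Dec; does)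
open import Relation.Nullary.Decidable using (_×-dec_; _⊎-dec_)

next prev : ∀ {m} → Fin m → Fin m
next {suc m} i = suc (toℕ i) mod suc m
prev {suc m} i = (toℕ i + m) mod suc m

-- A Gauss code on the symbols Fin n, read from an arbitrary starting point;
-- the positions Fin (2 * n) are in cyclic order under `next`.
record GaussCode (n : ℕ) : Set where
  field
    word  : Vec (Fin n) (2 * n)
    twice : ∀ s → count (_≟ s) word ≡ 2

module _ {n : ℕ} (X : GaussCode n) where
  open GaussCode X

  Alternate : Fin n → Fin n → Set
  Alternate p q =
    ∃[ a ] ∃[ b ] ∃[ c ] ∃[ d ]
      (a < b × b < c × c < d ×
       lookup word a ≡ p × lookup word b ≡ q ×
       lookup word c ≡ p × lookup word d ≡ q)

  -- (p,q,p,q) is a cyclic subsequence iff one of its rotations pqpq, qpqp is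
  -- a subsequence of the linear word.  Since each symbol occurs only twice,
  -- this already forces p ≢ q.
  Interlaced : Fin n → Fin n → Set
  Interlaced p q = Alternate p q ⊎ Alternate q p

  alternate? : ∀ p q → Dec (Alternate p q)
  alternate? p q =
    any? λ a → any? λ b → any? λ c → any? λ d →
      a <? b ×-dec b <? c ×-dec c <? d ×-dec
      lookup word a ≟ p ×-dec lookup word b ≟ q ×-dec
      lookup word c ≟ p ×-dec lookup word d ≟ q

  interlaced? : ∀ p q → Dec (Interlaced p q)
  interlaced? p q = alternate? p q ⊎-dec alternate? q p

  interlacedWith : Fin n → Subset n
  interlacedWith p = tabulate λ q → does (interlaced? p q)

-- The half-edges of a 4-regular graph with vertex set Fin n: (v , i) is the
-- i-th half-edge at v in the local rotation.
Dart : ℕ → Set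
Dart n = Fin n × Fin 4

-- A dart with one of its two sides: `true` is the side facing the next dart
-- of the rotation at its vertex, `false` the side facing the previous one.
Flag : ℕ → Set
Flag n = Dart n × Bool

-- A 4-regular graph (loops and parallel edges allowed) with a rotation at each
-- vertex and a signature on the edges.  Up to homeomorphism these describe
-- exactly the embeddings with open-disc faces in closed surfaces, orientable
-- or not.  `twisted e` says that the local orientations at the two ends of e
-- disagree when transported along e.
record RotationSystem (n : ℕ) : Set where
  field
    edges   : ℕ
    ends    : Dart n ↔ (Fin edges × Bool)
    twisted : Fin edges → Bool

  open Inverse ends using (to; from)

  edge : Dart n → Fin edges
  edge d = proj₁ (to d)

  otherEnd : Dart n → Dart n
  otherEnd d with to d
  ... | e , b = from (e , not b)

  -- Traverse the edge of d away from the vertex of d, then leave the vertex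
  -- reached along the half-edge opposite to the one of arrival.
  straight : Dart n → Dart n
  straight d with otherEnd d
  ... | v , i = v , next (next i)

  corner : Flag n → Flag n
  corner ((v , i) , true)  = (v , next i) , false
  corner ((v , i) , false) = (v , prev i) , true

  -- Each dart is seen from its own vertex, so along an untwisted edge the
  -- `true` side of one end is the `false` side of the other.
  alongEdge : Flag n → Flag n
  alongEdge (d , s) = otherEnd d , (if twisted (edge d) then s else not s)

  BoundaryStep : Flag n → Flag n → Set
  BoundaryStep f g = (g ≡ corner f) ⊎ (g ≡ alongEdge f)

  SameFace : Flag n → Flag n → Set
  SameFace = EqClosure BoundaryStep

record Embedding (n : ℕ) : Set where
  field
    rotationSystem : RotationSystem n

  open RotationSystem rotationSystem public

  field
    faces           : ℕ
    face            : Flag n → Fin faces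
    face-surjective : StrictlySurjective _≡_ face
    face-exact      : ∀ f g → face f ≡ face g ⇔ SameFace f g

  χ : ℤ
  χ = + n ℤ.- + edges ℤ.+ + faces

  connectivity : ℤ
  connectivity = + 2 ℤ.- χ

  TwoColourable : Set
  TwoColourable =
    Σ[ colour ∈ (Fin faces → Bool) ]
      (∀ d → colour (face (d , true)) ≢ colour (face (d , false)))

  -- w is a smooth closed walk, given by the dart along which it leaves each
  -- vertex visited.  Having H as a single smooth path means that the walk
  -- traverses every edge exactly once; in particular the surface is connected.
  record IsOnlySmoothPath {m : ℕ} (w : Fin m → Dart n) : Set where
    field
      smooth : ∀ i → w (next i) ≡ straight (w i)
      covers : ∀ e → ∃! _≡_ λ i → edge (w i) ≡ e

  -- The vertices of H are the symbols themselves.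
  Spells : GaussCode n → Set
  Spells X =
    Σ[ w ∈ (Fin (2 * n) → Dart n) ]
      (IsOnlySmoothPath w × (∀ i → proj₁ (w i) ≡ lookup (GaussCode.word X) i))

open Embedding using (connectivity; TwoColourable; Spells)

-- Realizable in some closed surface of connectivity at most k.
RealizableWithin : ∀ {n} → ℤ → GaussCode n → Set
RealizableWithin {n} k X =
  Σ[ H ∈ Embedding n ]
    (connectivity H ℤ.≤ k × TwoColourable H × Spells H X)

Odd : ℕ → Set
Odd k = k % 2 ≡ 1

interlaceCount : ∀ {n} → GaussCode n → Fin n → Fin n → ℕ
interlaceCount X y z =
  ∣ i y ∩ i z ∣ + ∣ i y ∣ * ∣ i z ∣
  where i = interlacedWith X

{-# OPTIONS --safe #-}
-- Fix the two-coloured embeddings whose smooth path is X: at each vertex v there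
-- is one binary choice D v, namely which colour of corner joins the two outgoing
-- edge-ends.  Every edge has exactly one side of either colour β, so a GF(2)-valued
-- function that is constant on the faces of colour β is a function g on the edges.
-- The jump of g along the path is the same at both visits of v; call it x v.  Then
-- g is recovered from x and one constant, and the corners at v impose exactly
-- that x is in the kernel of M = I + diag D for one colour and of M + 1 for
-- the other, I being the interlace matrix.  As ker M × ker (M + 1) ≅ ker (M² + M),
-- a surface with f faces has 2 ^ f = 4 · |ker (M² + M)|.  Connectivity at most 1
-- means f ≥ n + 1, i.e. N = M² + M has rank at most 1; being symmetric over GF(2),
-- this says N y z = N y y · N z z, which is the colouring condition because
-- N y y = |i(y)| and N y z = |i(y) ∩ i(z)| + [y, z interlaced][D y = D z] modulo 2.
module Submission where

open import Defs
open import Algebra.Bundles using (CommutativeRing)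
open import Data.Bool using (Bool; true; false; if_then_else_; not; _xor_; _∧_)
open import Data.Bool.Properties
  using (T-≡; not-¬; ¬-not; not-involutive; not-injective; ∧-assoc; ∧-comm; ∧-idem; ∧-zeroʳ;
         ∧-conicalˡ; ∧-conicalʳ; ∧-distribˡ-xor; ∧-distribʳ-xor; ∨-comm; true-xor; xor-same;
         xor-assoc; xor-comm; xor-identityʳ; xor-inverseˡ; not-distribˡ-xor; xor-∧-commutativeRing)
open import Algebra.Properties.Semiring.Sum (CommutativeRing.semiring xor-∧-commutativeRing)
  using (sum; sum-syntax; sum-cong-≗; ∑-distrib-+; ∑-comm; sum-replicate-zero;
         *-distribˡ-sum; *-distribʳ-sum)
open import Data.Bool.Solver using (module xor-∧-Solver)
open import Data.Fin
  using (Fin; zero; suc; toℕ; fromℕ; inject₁; punchIn; punchOut; combine; funToFin; finToFun; _<_; _≟_)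
open import Data.Fin.Induction using (<-weakInduction)
open import Data.Fin.Patterns using (0F; 1F; 2F; 3F)
open import Data.Fin.Properties
  using (toℕ-injective; toℕ-fromℕ<; toℕ-inject₁; toℕ-fromℕ; toℕ<n; 2↔Bool; *↔×; all?;
         funToFin-finToFin; finToFun-funToFin; injective⇒≤; punchInᵢ≢i; punchOut-cong;
         punchOut-injective; punchOut-punchIn; <-cmp; <-trans; <-irrefl; <-asym)
open import Data.Fin.Relation.Unary.Top using (view; ‵fromℕ; ‵inject₁)
open import Data.Fin.Subset using (Subset; _∩_; ∣_∣)
open import Data.Integer as ℤ using (+_)
import Data.Integer.Properties as ℤₚ
open import Data.Integer.Solver using (module +-*-Solver)
open import Data.List using (List; []; _∷_; _++_; map; allFin)
open import Data.List.Membership.Propositional using (_∈_)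
open import Data.List.Membership.Propositional.Properties
  using (∈-map⁺; ∈-map⁻; ∈-++⁺ˡ; ∈-++⁺ʳ; ∈-++⁻; ∈-allFin)
open import Data.List.Relation.Unary.Any using (here; there)
open import Data.Nat as ℕ using (ℕ; zero; suc; NonZero; _^_; _%_; _<ᵇ_; s≤s; z<s; s<s)
open import Data.Nat.DivMod using (m<n⇒m%n≡m; n%n≡0; [m+n]%n≡m%n)
import Data.Nat.Properties as ℕₚ
open import Data.Product using (Σ-syntax; ∃-syntax; _×_; _,_; proj₁; proj₂)
open import Data.Product.Function.NonDependent.Propositional using (_×-↔_)
open import Data.Sum as Sum using (_⊎_; inj₁; inj₂; [_,_]′)
open import Data.Vec using (Vec; []; _∷_; lookup; count)
open import Data.Vec.Functional using () renaming (_∷_ to _∷ᶠ_)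
open import Data.Vec.Properties using (lookup-zipWith; lookup∘tabulate)
open import Function using (_⇔_; _↔_; StrictlySurjective; _∘_; mk⇔; mk↔ₛ′)
open import Function.Bundles using (Inverse; Equivalence)
open import Function.Properties.Inverse using (↔-sym; ↔-trans)
open import Level using (0ℓ)
open import Relation.Binary.Core using (Rel)
open import Relation.Binary.Construct.Closure.Equivalence as EqC using (EqClosure)
open import Relation.Binary.Definitions using (tri<; tri≈; tri>)
open import Relation.Binary.PropositionalEquality
  using (_≡_; _≢_; _≗_; refl; sym; trans; cong; cong₂; subst; isEquivalence; module ≡-Reasoning)
open import Relation.Nullary using (¬_; Dec; does; yes; no; contradiction)
open import Relation.Nullary.Decidable using (dec-true; dec-false; toWitness; _⊎-dec_)
open import Relation.Unary using (Pred; Decidable)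
open xor-∧-Solver using (solve; _:+_; _:*_; _:=_; con)

-- Cyclic positions

next-inject₁ : ∀ {m} (i : Fin m) → next (inject₁ i) ≡ suc i
next-inject₁ {m} i = toℕ-injective (begin
  toℕ (next (inject₁ i))           ≡⟨ toℕ-fromℕ< _ ⟩
  suc (toℕ (inject₁ i)) % suc m    ≡⟨ cong (λ k → suc k % suc m) (toℕ-inject₁ i) ⟩
  suc (toℕ i) % suc m              ≡⟨ m<n⇒m%n≡m (s<s (toℕ<n i)) ⟩
  suc (toℕ i)                      ∎)
  where open ≡-Reasoning

next-fromℕ : ∀ m → next (fromℕ m) ≡ zero
next-fromℕ m = toℕ-injective (begin
  toℕ (next (fromℕ m))        ≡⟨ toℕ-fromℕ< _ ⟩
  suc (toℕ (fromℕ m)) % suc m ≡⟨ cong (λ k → suc k % suc m) (toℕ-fromℕ m) ⟩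
  suc m % suc m               ≡⟨ n%n≡0 (suc m) ⟩
  0                           ∎)
  where open ≡-Reasoning

prev-zero : ∀ m → prev {suc m} zero ≡ fromℕ m
prev-zero m = toℕ-injective (begin
  toℕ (prev {suc m} zero) ≡⟨ toℕ-fromℕ< _ ⟩
  m % suc m               ≡⟨ m<n⇒m%n≡m (ℕₚ.n<1+n m) ⟩
  m                       ≡⟨ toℕ-fromℕ m ⟨
  toℕ (fromℕ m)           ∎)
  where open ≡-Reasoning

prev-suc : ∀ {m} (i : Fin m) → prev (suc i) ≡ inject₁ i
prev-suc {m} i = toℕ-injective (begin
  toℕ (prev (suc i))         ≡⟨ toℕ-fromℕ< _ ⟩
  (suc (toℕ i) ℕ.+ m) % suc m  ≡⟨ cong (_% suc m) (ℕₚ.+-suc (toℕ i) m) ⟨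
  (toℕ i ℕ.+ suc m) % suc m    ≡⟨ [m+n]%n≡m%n (toℕ i) (suc m) ⟩
  toℕ i % suc m              ≡⟨ m<n⇒m%n≡m (ℕₚ.m<n⇒m<1+n (toℕ<n i)) ⟩
  toℕ i                      ≡⟨ toℕ-inject₁ i ⟨
  toℕ (inject₁ i)            ∎)
  where
  open ≡-Reasoning

next-prev : ∀ {m} (i : Fin m) → next (prev i) ≡ i
next-prev {suc m} zero    = trans (cong next (prev-zero m)) (next-fromℕ m)
next-prev {suc m} (suc i) = trans (cong next (prev-suc i)) (next-inject₁ i)

prev-next : ∀ {m} (i : Fin m) → prev (next i) ≡ i
prev-next {suc m} i with view i
... | ‵fromℕ     = trans (cong prev (next-fromℕ m)) (prev-zero m)
... | ‵inject₁ j = trans (cong prev (next-inject₁ j)) (prev-suc j)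

-- Comparing dimensions over GF(2) by counting Boolean vectors

module _ {a b : ℕ} (F : (Fin a → Bool) → (Fin b → Bool))
         (F-injective : ∀ {x y} → F x ≗ F y → x ≗ y) where

  private
    open Inverse 2↔Bool using (to; from; strictlyInverseˡ; strictlyInverseʳ)

    decode : Fin (2 ^ a) → Fin a → Bool
    decode k = to ∘ finToFun k

    encode : Fin (2 ^ a) → Fin (2 ^ b)
    encode k = funToFin (from ∘ F (decode k))

    from-injective : ∀ {x y} → from x ≡ from y → x ≡ y
    from-injective e = trans (sym (strictlyInverseˡ _)) (trans (cong to e) (strictlyInverseˡ _))

    to-injective : ∀ {x y} → to x ≡ to y → x ≡ y
    to-injective e = trans (sym (strictlyInverseʳ _)) (trans (cong from e) (strictlyInverseʳ _))

    funToFin-cong : ∀ {m k} {f g : Fin m → Fin k} → f ≗ g → funToFin f ≡ funToFin g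
    funToFin-cong {zero}  _ = refl
    funToFin-cong {suc m} e = cong₂ combine (e zero) (funToFin-cong (e ∘ suc))

    funToFin-injective : ∀ {m k} {f g : Fin m → Fin k} → funToFin f ≡ funToFin g → f ≗ g
    funToFin-injective {f = f} {g} e i =
      trans (sym (finToFun-funToFin f i))
            (trans (cong (λ k → finToFun k i) e) (finToFun-funToFin g i))

    encode-injective : ∀ {k l} → encode k ≡ encode l → k ≡ l
    encode-injective {k} {l} e = begin
      k                              ≡⟨ funToFin-finToFin {a} {2} k ⟨
      funToFin (finToFun {2} {a} k)  ≡⟨ funToFin-cong {a} (λ i → to-injective (decode≗ i)) ⟩
      funToFin (finToFun {2} {a} l)  ≡⟨ funToFin-finToFin {a} {2} l ⟩
      l                              ∎
      where
      open ≡-Reasoning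
      decode≗ : decode k ≗ decode l
      decode≗ = F-injective (from-injective ∘ funToFin-injective {b} e)

  -- Stands in for a comparison of dimensions over GF(2): if `b < a`, the `2 ^ a` Boolean vectors
  -- could not be injected into the `2 ^ b` ones. Vectors are compared pointwise, so they are first
  -- encoded as numbers, where injectivity is about `≡`.
  cube-injection⇒≤ : a ℕ.≤ b
  cube-injection⇒≤ = ℕₚ.≮⇒≥ λ b<a → ℕₚ.<⇒≱ (ℕₚ.^-monoʳ-< 2 (s<s z<s) b<a) (injective⇒≤ encode-injective)

-- Quotients of finite types

-- The data that an `Embedding` demands of its faces, for an arbitrary generating relation in place
-- of `BoundaryStep`.
FiniteQuotient : {A : Set} → Rel A 0ℓ → Set
FiniteQuotient {A} R =
  Σ[ k ∈ ℕ ] Σ[ class ∈ (A → Fin k) ]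
    StrictlySurjective _≡_ class × (∀ x y → class x ≡ class y ⇔ EqClosure R x y)

module _ {A : Set} where

  Listed : List (A × A) → Rel A 0ℓ
  Listed ps x y = (x , y) ∈ ps

  private
    -- The new pair joins two distinct classes: the label of `t` is redirected to that of `s`, and
    -- `punchOut` then closes the gap left by the abandoned label.
    module Merge (s t : A) (ps : List (A × A)) {k : ℕ} (class : A → Fin (suc k))
                 (surjective : StrictlySurjective _≡_ class)
                 (exact : ∀ x y → class x ≡ class y ⇔ EqClosure (Listed ps) x y)
                 (t≢s : class t ≢ class s) where

      open module Exact {x} {y} = Equivalence (exact x y)

      _~_ : Rel A 0ℓ
      _~_ = EqClosure (Listed ((s , t) ∷ ps))

      redirect : Fin (suc k) → Fin (suc k)
      redirect j = if does (class t ≟ j) then class s else j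

      redirect-avoids : ∀ j → class t ≢ redirect j
      redirect-avoids j with class t ≟ j
      ... | yes _  = t≢s
      ... | no t≢j = t≢j

      class′ : A → Fin k
      class′ x = punchOut (redirect-avoids (class x))

      redirect-s : redirect (class s) ≡ class s
      redirect-s with class t ≟ class s
      ... | yes _ = refl
      ... | no _  = refl

      redirect-t : redirect (class t) ≡ class s
      redirect-t with class t ≟ class t
      ... | yes _  = refl
      ... | no t≢t = contradiction refl t≢t

      -- A redirected label is still the old label of some element equivalent to `x`, so exactness
      -- of the old quotient can be applied to it.
      redirected : ∀ x → ∃[ x′ ] (class x′ ≡ redirect (class x) × x ~ x′)
      redirected x with class t ≟ class x
      ... | yes t≡x = s , refl ,
            EqC.transitive _ (EqC.map there (to (sym t≡x)))
                             (EqC.symmetric _ (EqC.return (here refl)))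
      ... | no _    = x , refl , EqC.reflexive _

      class′-cong : ∀ {x y} → redirect (class x) ≡ redirect (class y) → class′ x ≡ class′ y
      class′-cong = punchOut-cong (class t)

      class′-surjective : StrictlySurjective _≡_ class′
      class′-surjective j with surjective (punchIn (class t) j)
      ... | x , eq = x , trans (punchOut-cong (class t) {i≢k = punchInᵢ≢i _ _ ∘ sym} redirect-x)
                               (punchOut-punchIn (class t))
        where
        redirect-x : redirect (class x) ≡ punchIn (class t) j
        redirect-x with class t ≟ class x
        ... | yes t≡x = contradiction (sym (trans t≡x eq)) (punchInᵢ≢i _ _)
        ... | no _    = eq

      sound : ∀ {x y} → class′ x ≡ class′ y → x ~ y
      sound {x} {y} e with redirected x | redirected y
      ... | x′ , ex , x~x′ | y′ , ey , y~y′ =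
        EqC.transitive _ x~x′
          (EqC.transitive _
            (EqC.map there (to (trans ex (trans (punchOut-injective (redirect-avoids (class x)) (redirect-avoids (class y)) e) (sym ey)))))
            (EqC.symmetric _ y~y′))

      complete : ∀ {x y} → x ~ y → class′ x ≡ class′ y
      complete = EqC.gfold isEquivalence class′ λ where
        (here refl) → class′-cong (trans redirect-s (sym redirect-t))
        (there p)   → class′-cong (cong redirect (from (EqC.return p)))

  merge : ∀ s t ps → FiniteQuotient (Listed ps) → FiniteQuotient (Listed ((s , t) ∷ ps))
  merge s t ps (zero  , class , _) with () ← class s
  merge s t ps (suc k , class , surjective , exact) with class t ≟ class s
  ... | yes t≡s = suc k , class , surjective , λ x y → mk⇔
        (λ e → EqC.map there (Equivalence.to (exact x y) e))
        (EqC.gfold isEquivalence class λ where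
          (here refl) → sym t≡s
          (there p)   → Equivalence.from (exact _ _) (EqC.return p))
  ... | no t≢s = k , class′ , class′-surjective , λ x y → mk⇔ sound complete
    where open Merge s t ps class surjective exact t≢s

  -- Induction on the generating pairs, from the discrete quotient; each pair either lies within one
  -- class already or merges two.
  finiteQuotient : ∀ {N} → A ↔ Fin N → ∀ ps → FiniteQuotient (Listed ps)
  finiteQuotient {N} A↔Fin [] =
    N , to , (λ j → from j , strictlyInverseˡ j) , λ x y → mk⇔
      (λ e → subst (EqClosure (Listed []) x)
                   (trans (sym (strictlyInverseʳ x)) (trans (cong from e) (strictlyInverseʳ y)))
                   (EqC.reflexive _))
      (EqC.gfold isEquivalence to λ ())
    where open Inverse A↔Fin
  finiteQuotient A↔Fin ((s , t) ∷ ps) = merge s t ps (finiteQuotient A↔Fin ps)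

-- Positions of a symbol that occurs twice

module _ {A : Set} {P : Pred A 0ℓ} (P? : Decidable P) where

  count≡0⇒none : ∀ {m} (xs : Vec A m) → count P? xs ≡ 0 → ∀ i → ¬ P (lookup xs i)
  count≡0⇒none (x ∷ xs) e i p with P? x
  count≡0⇒none (x ∷ xs) e zero    p | no ¬p = ¬p p
  count≡0⇒none (x ∷ xs) e (suc i) p | no ¬p = count≡0⇒none xs e i p

  count≡1⇒one : ∀ {m} (xs : Vec A m) → count P? xs ≡ 1 →
    ∃[ a ] (P (lookup xs a) × (∀ i → P (lookup xs i) → i ≡ a))
  count≡1⇒one (x ∷ xs) e with P? x
  ... | yes p = zero , p , λ where
        zero    _ → refl
        (suc i) q → contradiction q (count≡0⇒none xs (ℕₚ.suc-injective e) i)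
  ... | no ¬p with count≡1⇒one xs e
  ...   | a , p , unique = suc a , p , λ where
          zero    q → contradiction q ¬p
          (suc i) q → cong suc (unique i q)

  count≡2⇒two : ∀ {m} (xs : Vec A m) → count P? xs ≡ 2 →
    ∃[ a ] ∃[ b ] (a < b × P (lookup xs a) × P (lookup xs b) ×
                   (∀ i → P (lookup xs i) → i ≡ a ⊎ i ≡ b))
  count≡2⇒two (x ∷ xs) e with P? x
  ... | yes p with count≡1⇒one xs (ℕₚ.suc-injective e)
  ...   | b , q , unique = zero , suc b , z<s , p , q , λ where
          zero    _ → inj₁ refl
          (suc i) r → inj₂ (cong suc (unique i r))
  count≡2⇒two (x ∷ xs) e | no ¬p with count≡2⇒two xs e
  ...   | a , b , a<b , p , q , complete = suc a , suc b , s<s a<b , p , q , λ where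
          zero    r → contradiction r ¬p
          (suc i) r → Sum.map (cong suc) (cong suc) (complete i r)

-- Quotients generated by two functions

module _ {A : Set} {N : ℕ} (A↔Fin : A ↔ Fin N) where
  open Inverse A↔Fin

  private
    graph : (A → A) → List (A × A)
    graph r = map (λ i → from i , r (from i)) (allFin N)

    graph⁻ : ∀ r {x y} → (x , y) ∈ graph r → y ≡ r x
    graph⁻ r xy∈ with ∈-map⁻ (λ i → from i , r (from i)) xy∈
    ... | _ , _ , refl = refl

    graph⁺ : ∀ r x → (x , r x) ∈ graph r
    graph⁺ r x = subst (λ x → (x , r x) ∈ graph r) (strictlyInverseʳ x)
                       (∈-map⁺ (λ i → from i , r (from i)) (∈-allFin (to x)))

  -- On a finite type the graphs of `p` and `q` form a finite list of generating pairs. With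
  -- `corner` and `alongEdge` this produces the faces of a rotation system.
  functionalQuotient : (p q : A → A) → FiniteQuotient (λ x y → y ≡ p x ⊎ y ≡ q x)
  functionalQuotient p q with finiteQuotient A↔Fin (graph p ++ graph q)
  ... | k , class , surjective , exact = k , class , surjective , λ x y → mk⇔
        (EqC.map listed⇒step ∘ Equivalence.to (exact x y))
        (Equivalence.from (exact x y) ∘ EqC.map step⇒listed)
    where
    listed⇒step : ∀ {x y} → (x , y) ∈ graph p ++ graph q → y ≡ p x ⊎ y ≡ q x
    listed⇒step xy∈ = Sum.map (graph⁻ p) (graph⁻ q) (∈-++⁻ (graph p) xy∈)

    step⇒listed : ∀ {x y} → y ≡ p x ⊎ y ≡ q x → (x , y) ∈ graph p ++ graph q
    step⇒listed {x} (inj₁ refl) = ∈-++⁺ˡ (graph⁺ p x)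
    step⇒listed {x} (inj₂ refl) = ∈-++⁺ʳ (graph p) (graph⁺ q x)

-- Sums over GF(2) and the interlace matrix

sum-false : ∀ n → ∑[ i < n ] false ≡ false
sum-false = sum-replicate-zero

sum-δ : ∀ {m} (i : Fin m) (f : Fin m → Bool) → ∑[ j < m ] (does (j ≟ i) ∧ f j) ≡ f i
sum-δ {suc m} zero    f = trans (cong (f zero xor_) (sum-false m)) (xor-identityʳ _)
sum-δ {suc m} (suc i) f = sum-δ i (f ∘ suc)

_≤ᵇ_ : ∀ {m} → Fin m → Fin m → Bool
i ≤ᵇ j = toℕ i <ᵇ suc (toℕ j)

prefixSum : ∀ {m} → (Fin m → Bool) → Fin m → Bool
prefixSum {m} f i = ∑[ j < m ] ((j ≤ᵇ i) ∧ f j)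

prefixSum-zero : ∀ {m} (f : Fin (suc m) → Bool) → prefixSum f zero ≡ f zero
prefixSum-zero {m} f = trans (cong (f zero xor_) (sum-false m)) (xor-identityʳ _)

prefixSum-suc : ∀ {m} (f : Fin (suc m) → Bool) i →
                prefixSum f (suc i) ≡ prefixSum f (inject₁ i) xor f (suc i)
prefixSum-suc {suc m} f zero =
  cong₂ _xor_ (sym (prefixSum-zero f)) (prefixSum-zero (f ∘ suc))
prefixSum-suc {suc m} f (suc i) =
  trans (cong (f zero xor_) (prefixSum-suc (f ∘ suc) i)) (sym (xor-assoc (f zero) _ _))

prefixSum-fromℕ : ∀ {m} (f : Fin (suc m) → Bool) → prefixSum f (fromℕ m) ≡ sum f
prefixSum-fromℕ {zero}  f = refl
prefixSum-fromℕ {suc m} f = cong (f zero xor_) (prefixSum-fromℕ (f ∘ suc))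

-- The vanishing total is what closes the antiderivative up cyclically: at the wrap-around the value
-- at the last position is the total.
prefixSum-next : ∀ {m} (f : Fin m → Bool) → sum f ≡ false →
                 ∀ i → prefixSum f (next i) ≡ prefixSum f i xor f (next i)
prefixSum-next {suc m} f sum≡0 i with view i
... | ‵inject₁ j rewrite next-inject₁ j = prefixSum-suc f j
... | ‵fromℕ     rewrite next-fromℕ m = begin
  prefixSum f zero                    ≡⟨ prefixSum-zero f ⟩
  f zero                              ≡⟨⟩
  false xor f zero                    ≡⟨ cong (_xor f zero) (trans (prefixSum-fromℕ f) sum≡0) ⟨
  prefixSum f (fromℕ m) xor f zero    ∎
  where open ≡-Reasoning

-- An antiderivative is unique up to a constant. The constant is the value at the last position,
-- from which the step to position zero adds `f zero`, the first inclusive prefix sum.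
cyclic-antiderivative : ∀ {m} (f g : Fin (suc m) → Bool) →
  (∀ i → g (next i) ≡ g i xor f (next i)) →
  ∀ i → g i ≡ g (fromℕ m) xor prefixSum f i
cyclic-antiderivative {m} f g step = go
  where
  open ≡-Reasoning
  stepˢ : ∀ i → g (suc i) ≡ g (inject₁ i) xor f (suc i)
  stepˢ i = subst (λ k → g k ≡ g (inject₁ i) xor f k) (next-inject₁ i) (step (inject₁ i))

  go : ∀ i → g i ≡ g (fromℕ m) xor prefixSum f i
  go = <-weakInduction (λ i → g i ≡ g (fromℕ m) xor prefixSum f i)
    (begin
      g zero                               ≡⟨ cong g (next-fromℕ m) ⟨
      g (next (fromℕ m))                   ≡⟨ step (fromℕ m) ⟩
      g (fromℕ m) xor f (next (fromℕ m))   ≡⟨ cong (λ k → g (fromℕ m) xor f k) (next-fromℕ m) ⟩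
      g (fromℕ m) xor f zero               ≡⟨ cong (g (fromℕ m) xor_) (prefixSum-zero f) ⟨
      g (fromℕ m) xor prefixSum f zero     ∎)
    (λ i ih → begin
      g (suc i)                                                  ≡⟨ stepˢ i ⟩
      g (inject₁ i) xor f (suc i)                                ≡⟨ cong (_xor f (suc i)) ih ⟩
      (g (fromℕ m) xor prefixSum f (inject₁ i)) xor f (suc i)    ≡⟨ xor-assoc (g (fromℕ m)) _ _ ⟩
      g (fromℕ m) xor (prefixSum f (inject₁ i) xor f (suc i))    ≡⟨ cong (g (fromℕ m) xor_) (prefixSum-suc f i) ⟨
      g (fromℕ m) xor prefixSum f (suc i)                        ∎)

≤ᵇ-true : ∀ {m} {i j : Fin m} → i Data.Fin.≤ j → (i ≤ᵇ j) ≡ true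
≤ᵇ-true i≤j = Equivalence.to T-≡ (ℕₚ.<⇒<ᵇ (s≤s i≤j))

≤ᵇ-false : ∀ {m} {i j : Fin m} → j < i → (i ≤ᵇ j) ≡ false
≤ᵇ-false {i = i} {j} j<i with i ≤ᵇ j in eq
... | false = refl
... | true  = contradiction (ℕₚ.<ᵇ⇒< (toℕ i) (suc (toℕ j)) (Equivalence.from T-≡ eq)) (ℕₚ.≤⇒≯ j<i ∘ λ { (s≤s p) → s≤s p })

module Code {n : ℕ} (X : GaussCode n) where
  open GaussCode X public

  at : Fin (2 ℕ.* n) → Fin n
  at = lookup word

  private opaque
    occurrences : ∀ v → ∃[ i ] ∃[ j ] (i < j × at i ≡ v × at j ≡ v × (∀ k → at k ≡ v → k ≡ i ⊎ k ≡ j))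
    occurrences v = count≡2⇒two (_≟ v) word (twice v)

  first second : Fin n → Fin (2 ℕ.* n)
  first  v = proj₁ (occurrences v)
  second v = proj₁ (proj₂ (occurrences v))

  first<second : ∀ v → first v < second v
  first<second v = proj₁ (proj₂ (proj₂ (occurrences v)))

  at-first : ∀ v → at (first v) ≡ v
  at-first v = proj₁ (proj₂ (proj₂ (proj₂ (occurrences v))))

  at-second : ∀ v → at (second v) ≡ v
  at-second v = proj₁ (proj₂ (proj₂ (proj₂ (proj₂ (occurrences v)))))

  occurs : ∀ {v i} → at i ≡ v → i ≡ first v ⊎ i ≡ second v
  occurs {v} = proj₂ (proj₂ (proj₂ (proj₂ (proj₂ (occurrences v))))) _

  first≢second : ∀ v → first v ≢ second v
  first≢second v e = <-irrefl e (first<second v)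

  private
    occurrence-δ : ∀ i v → does (v ≟ at i) ≡ does (i ≟ first v) xor does (i ≟ second v)
    occurrence-δ i v with i ≟ first v | i ≟ second v
    ... | yes e | yes e′ = contradiction (trans (sym e) e′) (first≢second v)
    ... | yes e | no  _  = dec-true  (v ≟ at i) (sym (trans (cong at e) (at-first v)))
    ... | no  _ | yes e  = dec-true  (v ≟ at i) (sym (trans (cong at e) (at-second v)))
    ... | no  a | no  b  = dec-false (v ≟ at i) λ e → [ a , b ]′ (occurs (sym e))

  -- Double counting: the sum is spread over the symbols with `sum-δ` and the order of summation
  -- exchanged, each symbol owning exactly two positions.
  sum-by-symbol : ∀ f → sum f ≡ ∑[ v < n ] (f (first v) xor f (second v))
  sum-by-symbol f = begin
    sum f
      ≡⟨ sum-cong-≗ (λ i → sym (sum-δ (at i) (λ _ → f i))) ⟩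
    ∑[ i < 2 ℕ.* n ] (∑[ v < n ] (does (v ≟ at i) ∧ f i))
      ≡⟨ ∑-comm (λ i v → does (v ≟ at i) ∧ f i) ⟩
    ∑[ v < n ] (∑[ i < 2 ℕ.* n ] (does (v ≟ at i) ∧ f i))
      ≡⟨ sum-cong-≗ {n} inner ⟩
    ∑[ v < n ] (f (first v) xor f (second v))
      ∎
    where
    open ≡-Reasoning
    inner : ∀ v → ∑[ i < 2 ℕ.* n ] (does (v ≟ at i) ∧ f i) ≡ f (first v) xor f (second v)
    inner v = begin
      ∑[ i < 2 ℕ.* n ] (does (v ≟ at i) ∧ f i)
        ≡⟨ sum-cong-≗ (λ i → trans (cong (_∧ f i) (occurrence-δ i v))
                                   (∧-distribʳ-xor (f i) (does (i ≟ first v)) (does (i ≟ second v)))) ⟩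
      ∑[ i < 2 ℕ.* n ] (does (i ≟ first v) ∧ f i xor does (i ≟ second v) ∧ f i)
        ≡⟨ ∑-distrib-+ (λ i → does (i ≟ first v) ∧ f i) (λ i → does (i ≟ second v) ∧ f i) ⟩
      ∑[ i < 2 ℕ.* n ] (does (i ≟ first v) ∧ f i) xor ∑[ i < 2 ℕ.* n ] (does (i ≟ second v) ∧ f i)
        ≡⟨ cong₂ _xor_ (sum-δ (first v) f) (sum-δ (second v) f) ⟩
      f (first v) xor f (second v)
        ∎

  -- Every symbol contributes its value twice. Jumps that depend on the symbol only therefore always
  -- have a cyclic antiderivative.
  sum-at≡false : ∀ (x : Fin n → Bool) → sum (x ∘ at) ≡ false
  sum-at≡false x = begin
    sum (x ∘ at)                                           ≡⟨ sum-by-symbol (x ∘ at) ⟩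
    ∑[ v < n ] (x (at (first v)) xor x (at (second v)))    ≡⟨ sum-cong-≗ (λ v → cong₂ (λ p q → x p xor x q) (at-first v) (at-second v)) ⟩
    ∑[ v < n ] (x v xor x v)                               ≡⟨ sum-cong-≗ (λ v → xor-same (x v)) ⟩
    ∑[ v < n ] false                                       ≡⟨ sum-false n ⟩
    false                                                  ∎
    where open ≡-Reasoning

  opaque
    I : Fin n → Fin n → Bool
    I v w = does (interlaced? X v w)

    I≡ : ∀ v w → does (interlaced? X v w) ≡ I v w
    I≡ v w = refl

    I-sym : ∀ v w → I v w ≡ I w v
    I-sym v w = ∨-comm (does (alternate? X v w)) _

  private
    two-occurrences : ∀ {v i j} → at i ≡ v → at j ≡ v → i < j → i ≡ first v × j ≡ second v
    two-occurrences {v} ei ej i<j with occurs ei | occurs ej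
    ... | inj₁ refl | inj₁ refl = contradiction i<j (<-irrefl refl)
    ... | inj₁ p    | inj₂ q    = p , q
    ... | inj₂ refl | inj₁ refl = contradiction i<j (<-asym (first<second v))
    ... | inj₂ refl | inj₂ refl = contradiction i<j (<-irrefl refl)

    alternate⁻ : ∀ {v w} → Alternate X v w → first v < first w × first w < second v × second v < second w
    alternate⁻ (a , b , c , d , a<b , b<c , c<d , ea , eb , ec , ed)
      with two-occurrences ea ec (<-trans a<b b<c) | two-occurrences eb ed (<-trans b<c c<d)
    ... | refl , refl | refl , refl = a<b , b<c , c<d

    alternate⁺ : ∀ {v w} → first v < first w → first w < second v → second v < second w → Alternate X v w
    alternate⁺ {v} {w} p q r =
      _ , _ , _ , _ , p , q , r , at-first v , at-first w , at-second v , at-second w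

  I-irrefl : ∀ v → I v v ≡ false
  I-irrefl v = trans (sym (I≡ v v)) (dec-false (interlaced? X v v) λ where
    (inj₁ alt) → <-irrefl refl (proj₁ (alternate⁻ alt))
    (inj₂ alt) → <-irrefl refl (proj₁ (alternate⁻ alt)))

  private
    -- The parity of the number of occurrences of `w` at positions not after `i`.
    upTo : Fin (2 ℕ.* n) → Fin n → Bool
    upTo i w = (first w ≤ᵇ i) xor (second w ≤ᵇ i)

    prefixSum-at : ∀ (x : Fin n → Bool) i → prefixSum (x ∘ at) i ≡ ∑[ w < n ] (upTo i w ∧ x w)
    prefixSum-at x i = trans (sum-by-symbol λ j → (j ≤ᵇ i) ∧ x (at j)) (sum-cong-≗ λ w →
      trans (cong₂ (λ p q → (first w ≤ᵇ i) ∧ x p xor (second w ≤ᵇ i) ∧ x q) (at-first w) (at-second w))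
            (sym (∧-distribʳ-xor (x w) (first w ≤ᵇ i) (second w ≤ᵇ i))))

    values : ∀ {a b c d a′ b′ c′ d′ : Bool} → a ≡ a′ → b ≡ b′ → c ≡ c′ → d ≡ d′ →
             (a xor b) xor (c xor d) ≡ (a′ xor b′) xor (c′ xor d′)
    values refl refl refl refl = refl

    <⇒≤ᵇ : ∀ {m} {i j : Fin m} → i < j → (i ≤ᵇ j) ≡ true
    <⇒≤ᵇ i<j = ≤ᵇ-true (ℕₚ.<⇒≤ i<j)

    -- Modulo 2 the left side counts the occurrences of `w` after `first v` and up to `second v`.
    -- For another symbol this is odd exactly under interlacement; for `w = v` only `second v` is
    -- counted, whence the identity matrix.
    crossings : ∀ v w → upTo (first v) w xor upTo (second v) w ≡ does (w ≟ v) xor I v w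
    crossings v w with w ≟ v
    ... | yes refl = trans (values (≤ᵇ-true {i = first v} {first v} ℕₚ.≤-refl) (≤ᵇ-false (first<second v))
                                   (<⇒≤ᵇ (first<second v)) (≤ᵇ-true {i = second v} {second v} ℕₚ.≤-refl))
                           (cong not (sym (I-irrefl v)))
    ... | no w≢v = go (<-cmp p a) (<-cmp p b) (<-cmp q a) (<-cmp q b)
      where
      a b p q : Fin (2 ℕ.* n)
      a = first v
      b = second v
      p = first w
      q = second w

      a<b : a < b
      a<b = first<second v
      p<q : p < q
      p<q = first<second w

      apart : ∀ {i j} → at i ≡ w → at j ≡ v → i ≢ j
      apart ei ej refl = w≢v (trans (sym ei) ej)

      interlaced : Interlaced X v w → I v w ≡ true
      interlaced p = trans (sym (I≡ v w)) (dec-true (interlaced? X v w) p)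

      separate : ¬ (a < p × p < b × b < q) → ¬ (p < a × a < q × q < b) → I v w ≡ false
      separate ¬vw ¬wv = trans (sym (I≡ v w)) (dec-false (interlaced? X v w) λ where
        (inj₁ alt) → ¬vw (alternate⁻ alt)
        (inj₂ alt) → ¬wv (alternate⁻ alt))

      go : _ → _ → _ → _ → ((p ≤ᵇ a) xor (q ≤ᵇ a)) xor ((p ≤ᵇ b) xor (q ≤ᵇ b)) ≡ I v w
      go (tri≈ _ p≡a _) _ _ _ = contradiction p≡a (apart (at-first w) (at-first v))
      go _ (tri≈ _ p≡b _) _ _ = contradiction p≡b (apart (at-first w) (at-second v))
      go _ _ (tri≈ _ q≡a _) _ = contradiction q≡a (apart (at-second w) (at-first v))
      go _ _ _ (tri≈ _ q≡b _) = contradiction q≡b (apart (at-second w) (at-second v))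
      -- Six orders of the four positions remain, given `a < b` and `p < q`; the two alternating
      -- ones are the interlaced cases.
      go (tri< p<a _ _) _ (tri< q<a _ _) _ =
        trans (values (<⇒≤ᵇ p<a) (<⇒≤ᵇ q<a) (<⇒≤ᵇ (<-trans p<a a<b)) (<⇒≤ᵇ (<-trans q<a a<b)))
              (sym (separate (λ (a<p , _) → <-asym p<a a<p) (λ (_ , a<q , _) → <-asym q<a a<q)))
      go (tri< p<a _ _) _ (tri> _ _ a<q) (tri< q<b _ _) =
        trans (values (<⇒≤ᵇ p<a) (≤ᵇ-false a<q) (<⇒≤ᵇ (<-trans p<a a<b)) (<⇒≤ᵇ q<b))
              (sym (interlaced (inj₂ (alternate⁺ p<a a<q q<b))))
      go (tri< p<a _ _) _ _ (tri> _ _ b<q) =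
        trans (values (<⇒≤ᵇ p<a) (≤ᵇ-false (<-trans a<b b<q)) (<⇒≤ᵇ (<-trans p<a a<b)) (≤ᵇ-false b<q))
              (sym (separate (λ (a<p , _) → <-asym p<a a<p) (λ (_ , _ , q<b) → <-asym q<b b<q)))
      go (tri> _ _ a<p) (tri< p<b _ _) _ (tri< q<b _ _) =
        trans (values (≤ᵇ-false a<p) (≤ᵇ-false (<-trans a<p p<q)) (<⇒≤ᵇ p<b) (<⇒≤ᵇ q<b))
              (sym (separate (λ (_ , _ , b<q) → <-asym q<b b<q) (λ (p<a , _) → <-asym p<a a<p)))
      go (tri> _ _ a<p) (tri< p<b _ _) _ (tri> _ _ b<q) =
        trans (values (≤ᵇ-false a<p) (≤ᵇ-false (<-trans a<p p<q)) (<⇒≤ᵇ p<b) (≤ᵇ-false b<q))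
              (sym (interlaced (inj₁ (alternate⁺ a<p p<b b<q))))
      go (tri> _ _ a<p) (tri> _ _ b<p) _ _ =
        trans (values (≤ᵇ-false a<p) (≤ᵇ-false (<-trans a<p p<q)) (≤ᵇ-false b<p) (≤ᵇ-false (<-trans b<p p<q)))
              (sym (separate (λ (_ , p<b , _) → <-asym p<b b<p) (λ (p<a , _) → <-asym p<a a<p)))

  -- The interlace matrix enters here: the values of an antiderivative at the two visits of `v`
  -- differ by a linear function of the jumps, with matrix identity plus `I`.
  prefixSum-between : ∀ (x : Fin n → Bool) v →
    prefixSum (x ∘ at) (first v) xor prefixSum (x ∘ at) (second v) ≡ x v xor ∑[ w < n ] (I v w ∧ x w)
  prefixSum-between x v = begin
    prefixSum (x ∘ at) (first v) xor prefixSum (x ∘ at) (second v)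
      ≡⟨ cong₂ _xor_ (prefixSum-at x (first v)) (prefixSum-at x (second v)) ⟩
    ∑[ w < n ] (upTo (first v) w ∧ x w) xor ∑[ w < n ] (upTo (second v) w ∧ x w)
      ≡⟨ ∑-distrib-+ (λ w → upTo (first v) w ∧ x w) (λ w → upTo (second v) w ∧ x w) ⟨
    ∑[ w < n ] (upTo (first v) w ∧ x w xor upTo (second v) w ∧ x w)
      ≡⟨ sum-cong-≗ (λ w → trans (sym (∧-distribʳ-xor (x w) (upTo (first v) w) (upTo (second v) w)))
                          (trans (cong (_∧ x w) (crossings v w)) (∧-distribʳ-xor (x w) (does (w ≟ v)) (I v w)))) ⟩
    ∑[ w < n ] (does (w ≟ v) ∧ x w xor I v w ∧ x w)
      ≡⟨ ∑-distrib-+ (λ w → does (w ≟ v) ∧ x w) (λ w → I v w ∧ x w) ⟩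
    ∑[ w < n ] (does (w ≟ v) ∧ x w) xor ∑[ w < n ] (I v w ∧ x w)
      ≡⟨ cong (_xor ∑[ w < n ] (I v w ∧ x w)) (sum-δ v x) ⟩
    x v xor ∑[ w < n ] (I v w ∧ x w)
      ∎
    where open ≡-Reasoning

-- The colouring condition as a rank condition

xor≡false⇒≡ : ∀ {a b} → a xor b ≡ false → a ≡ b
xor≡false⇒≡ {true}  {true}  _ = refl
xor≡false⇒≡ {false} {false} _ = refl

does⇔ : ∀ {P : Set} (P? : Dec P) → does P? ≡ true ⇔ P
does⇔ (yes p) = mk⇔ (λ _ → p) λ _ → refl
does⇔ (no ¬p) = mk⇔ (λ ()) λ p → contradiction p ¬p

module _ {n : ℕ} where

  infixr 7 _·_
  infixl 6 _⊕_

  _⊕_ : (x y : Fin n → Bool) → Fin n → Bool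
  (x ⊕ y) v = x v xor y v

  _·_ : (Fin n → Fin n → Bool) → (Fin n → Bool) → Fin n → Bool
  (A · x) v = ∑[ w < n ] (A v w ∧ x w)

  e : Fin n → Fin n → Bool
  e y v = does (v ≟ y)

  _⊛_ : Bool → (Fin n → Bool) → Fin n → Bool
  (b ⊛ x) v = b ∧ x v

  ·-cong : ∀ A {x y} → x ≗ y → A · x ≗ A · y
  ·-cong A x≗y v = sum-cong-≗ λ w → cong (A v w ∧_) (x≗y w)

  ·-⊕ : ∀ A x y → A · (x ⊕ y) ≗ A · x ⊕ A · y
  ·-⊕ A x y v = trans (sum-cong-≗ λ w → ∧-distribˡ-xor (A v w) (x w) (y w))
                      (∑-distrib-+ (λ w → A v w ∧ x w) (λ w → A v w ∧ y w))

  ·-scaled-basis : ∀ A b y v → (A · (b ⊛ e y)) v ≡ b ∧ A v y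
  ·-scaled-basis A b y v = trans
    (sum-cong-≗ λ w → solve 3 (λ a b d → a :* (b :* d) := d :* (b :* a)) refl (A v w) b (e y w))
    (sum-δ y (λ w → b ∧ A v w))

  module Quadratic (A : Fin n → Fin n → Bool) (A-sym : ∀ v w → A v w ≡ A w v)
                   (D : Fin n → Bool) where

    M : (Fin n → Bool) → Fin n → Bool
    M x v = (A · x) v xor (D v ∧ x v)

    -- The matrix of `M² + M` for `M = A + diag D`: the mixed products and `A` itself contribute
    -- `A y z` times `D y + D z + 1`, and `D² + D` vanishes over GF(2).
    N : Fin n → Fin n → Bool
    N y z = ∑[ w < n ] (A y w ∧ A z w) xor (A y z ∧ not (D y xor D z))

    N-sym : ∀ y z → N y z ≡ N z y
    N-sym y z = cong₂ _xor_ (sum-cong-≗ λ w → ∧-comm (A y w) (A z w))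
                            (cong₂ (λ a d → a ∧ not d) (A-sym y z) (xor-comm (D y) (D z)))

    M-cong : ∀ {x y} → x ≗ y → M x ≗ M y
    M-cong x≗y v = cong₂ _xor_ (·-cong A x≗y v) (cong (D v ∧_) (x≗y v))

    M-⊕ : ∀ x y → M (x ⊕ y) ≗ M x ⊕ M y
    M-⊕ x y v = trans (cong (_xor (D v ∧ (x v xor y v))) (·-⊕ A x y v))
      (solve 5 (λ a b d x y → (a :+ b) :+ d :* (x :+ y) := (a :+ d :* x) :+ (b :+ d :* y)) refl
        ((A · x) v) ((A · y) v) (D v) (x v) (y v))

    N≗M²⊕M : ∀ z → N · z ≗ M (M z) ⊕ M z
    N≗M²⊕M z v = begin
      ∑[ t < n ] (N v t ∧ z t)
        ≡⟨ sum-cong-≗ (λ t → expand (square t) (A v t) (D v) (D t) (z t)) ⟩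
      ∑[ t < n ] (square t ∧ z t xor (A v t ∧ (D t ∧ z t) xor (D v ∧ (A v t ∧ z t) xor A v t ∧ z t)))
        ≡⟨ ∑-distrib-+ (λ t → square t ∧ z t) _ ⟩
      ∑[ t < n ] (square t ∧ z t) xor
      ∑[ t < n ] (A v t ∧ (D t ∧ z t) xor (D v ∧ (A v t ∧ z t) xor A v t ∧ z t))
        ≡⟨ cong₂ _xor_ squares (trans (∑-distrib-+ (λ t → A v t ∧ (D t ∧ z t)) _)
             (cong ((A · Dz) v xor_) (trans (∑-distrib-+ (λ t → D v ∧ (A v t ∧ z t)) _)
               (cong (_xor (A · z) v) (sym (*-distribˡ-sum (D v) (λ t → A v t ∧ z t))))))) ⟩
      (A · (A · z)) v xor ((A · Dz) v xor (D v ∧ (A · z) v xor (A · z) v))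
        ≡⟨ regroup (D v) ((A · (A · z)) v) ((A · Dz) v) ((A · z) v) (z v) ⟩
      (((A · (A · z)) v xor (A · Dz) v) xor D v ∧ M z v) xor M z v
        ≡⟨ cong (λ s → (s xor D v ∧ M z v) xor M z v) (sym (·-⊕ A (A · z) Dz v)) ⟩
      M (M z) v xor M z v
        ∎
      where
      open ≡-Reasoning

      square : Fin n → Bool
      square t = ∑[ w < n ] (A v w ∧ A t w)

      Dz : Fin n → Bool
      Dz t = D t ∧ z t

      expand : ∀ s a d d′ x → (s xor a ∧ not (d xor d′)) ∧ x ≡
                              s ∧ x xor (a ∧ (d′ ∧ x) xor (d ∧ (a ∧ x) xor a ∧ x))
      expand s a d d′ x = trans (cong (λ k → (s xor a ∧ k) ∧ x) (sym (true-xor (d xor d′))))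
        (solve 5 (λ s a d d′ x → (s :+ a :* (con true :+ (d :+ d′))) :* x :=
                                 s :* x :+ (a :* (d′ :* x) :+ (d :* (a :* x) :+ a :* x)))
               refl s a d d′ x)

      -- The case split on `d` supplies `d ∧ d ≡ d`, which is not a commutative ring identity.
      regroup : ∀ d p q r x → p xor (q xor (d ∧ r xor r)) ≡
                              ((p xor q) xor d ∧ (r xor d ∧ x)) xor (r xor d ∧ x)
      regroup true  = solve 4 (λ p q r x → p :+ (q :+ (r :+ r)) :=
                                           ((p :+ q) :+ (r :+ x)) :+ (r :+ x)) refl
      regroup false = solve 4 (λ p q r x → p :+ (q :+ r) :=
                                           ((p :+ q) :+ con false) :+ (r :+ con false)) refl

      squares : ∑[ t < n ] (square t ∧ z t) ≡ (A · (A · z)) v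
      squares = begin
        ∑[ t < n ] (square t ∧ z t)
          ≡⟨ sum-cong-≗ (λ t → *-distribʳ-sum (z t) (λ w → A v w ∧ A t w)) ⟩
        ∑[ t < n ] (∑[ w < n ] ((A v w ∧ A t w) ∧ z t))
          ≡⟨ ∑-comm (λ t w → (A v w ∧ A t w) ∧ z t) ⟩
        ∑[ w < n ] (∑[ t < n ] ((A v w ∧ A t w) ∧ z t))
          ≡⟨ sum-cong-≗ {n} (λ w → sum-cong-≗ {n} λ t →
               trans (∧-assoc (A v w) (A t w) (z t)) (cong (λ a → A v w ∧ (a ∧ z t)) (A-sym t w))) ⟩
        ∑[ w < n ] (∑[ t < n ] (A v w ∧ (A w t ∧ z t)))
          ≡⟨ sum-cong-≗ {n} (λ w → sym (*-distribˡ-sum (A v w) (λ t → A w t ∧ z t))) ⟩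
        (A · (A · z)) v
          ∎

    -- `M` sends `x ⊕ y` to `y` and fixes `y`, so `M²` and `M` agree on the sum.
    N-kernel : ∀ {x y} → (∀ v → M x v ≡ false) → M y ≗ y → ∀ v → (N · (x ⊕ y)) v ≡ false
    N-kernel {x} {y} Mx≡0 My≡y v = begin
      (N · (x ⊕ y)) v                   ≡⟨ N≗M²⊕M (x ⊕ y) v ⟩
      M (M (x ⊕ y)) v xor M (x ⊕ y) v   ≡⟨ cong₂ _xor_ (trans (M-cong M[x⊕y] v) (My≡y v)) (M[x⊕y] v) ⟩
      y v xor y v                       ≡⟨ xor-same (y v) ⟩
      false                             ∎
      where
      open ≡-Reasoning
      M[x⊕y] : M (x ⊕ y) ≗ y
      M[x⊕y] v = trans (M-⊕ x y v) (cong₂ _xor_ (Mx≡0 v) (My≡y v))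

    -- Two columns over GF(2) are independent precisely when both are nonzero and they differ in
    -- some row; `columns` excludes this. In each case violating the conclusion, symmetry or the
    -- diagonal shows columns `y` and `z` to be nonzero, and they differ in row `y` or `z`.
    rank-one : (∀ {y z r₁ r₂ r₃} → N r₁ y ≡ true → N r₂ z ≡ true → ¬ N r₃ y ≢ N r₃ z) →
               ∀ y z → N y z ≡ N y y ∧ N z z
    rank-one columns y z with N y z in yz | N y y in yy | N z z in zz
    ... | true  | true  | true  = refl
    ... | true  | false | _     = contradiction
          (λ eq → contradiction (trans (sym yy) (trans eq yz)) λ ())
          (columns {r₁ = z} {r₂ = y} (trans (N-sym z y) yz) yz)
    ... | true  | true  | false = contradiction
          (λ eq → contradiction (trans (sym zz) (trans (sym eq) (trans (N-sym z y) yz))) λ ())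
          (columns {r₁ = z} {r₂ = y} (trans (N-sym z y) yz) yz)
    ... | false | true  | true  = contradiction
          (λ eq → contradiction (trans (sym yz) (trans (sym eq) yy)) λ ())
          (columns {r₁ = y} {r₂ = z} yy zz)
    ... | false | false | _     = refl
    ... | false | true  | false = refl

-- Parity of the interlace count

odd : ℕ → Bool
odd zero    = false
odd (suc k) = not (odd k)

Odd⇔odd : ∀ k → Odd k ⇔ odd k ≡ true
Odd⇔odd zero          = mk⇔ (λ ()) λ ()
Odd⇔odd (suc zero)    = mk⇔ (λ _ → refl) λ _ → refl
Odd⇔odd (suc (suc k)) = subst (λ b → Odd k ⇔ b ≡ true) (sym (not-involutive (odd k))) (Odd⇔odd k)

odd-+ : ∀ k l → odd (k ℕ.+ l) ≡ odd k xor odd l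
odd-+ zero    l = refl
odd-+ (suc k) l = trans (cong not (odd-+ k l)) (not-distribˡ-xor (odd k) (odd l))

odd-* : ∀ k l → odd (k ℕ.* l) ≡ odd k ∧ odd l
odd-* zero    l = refl
odd-* (suc k) l = trans (odd-+ l (k ℕ.* l)) (trans (cong (odd l xor_) (odd-* k l)) (absorb (odd k) (odd l)))
  where
  absorb : ∀ a b → b xor (a ∧ b) ≡ not a ∧ b
  absorb true  b = xor-same b
  absorb false b = xor-identityʳ b

odd-∣∣ : ∀ {n} (p : Subset n) → odd ∣ p ∣ ≡ ∑[ i < n ] lookup p i
odd-∣∣ []          = refl
odd-∣∣ (true  ∷ p) = cong not (odd-∣∣ p)
odd-∣∣ (false ∷ p) = odd-∣∣ p

module Criterion {n : ℕ} (X : GaussCode n) where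
  open Code X

  degree : Fin n → Bool
  degree y = ∑[ w < n ] I y w

  square : Fin n → Fin n → Bool
  square y z = ∑[ w < n ] (I y w ∧ I z w)

  odd-interlaceCount : ∀ y z →
    odd (interlaceCount X y z) ≡ square y z xor degree y ∧ degree z
  odd-interlaceCount y z = trans (odd-+ ∣ iʸ ∩ iᶻ ∣ (∣ iʸ ∣ ℕ.* ∣ iᶻ ∣)) (cong₂ _xor_
    (trans (odd-∣∣ (iʸ ∩ iᶻ)) (sum-cong-≗ λ w →
      trans (lookup-zipWith _∧_ w iʸ iᶻ) (cong₂ _∧_ (entry y w) (entry z w))))
    (trans (odd-* ∣ iʸ ∣ ∣ iᶻ ∣) (cong₂ _∧_ (size y) (size z))))
    where
    iʸ iᶻ : Subset n
    iʸ = interlacedWith X y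
    iᶻ = interlacedWith X z

    entry : ∀ v w → lookup (interlacedWith X v) w ≡ I v w
    entry v w = trans (lookup∘tabulate (λ q → does (interlaced? X v q)) w) (I≡ v w)

    size : ∀ v → odd ∣ interlacedWith X v ∣ ≡ degree v
    size v = trans (odd-∣∣ (interlacedWith X v)) (sum-cong-≗ (entry v))

  module _ (D : Fin n → Bool) where
    open Quadratic I I-sym D

    -- Idempotence turns the sum of squares into a degree, and the other term vanishes because
    -- `I y y` is false. The diagonal is thus independent of `D`.
    N-diagonal : ∀ y → N y y ≡ degree y
    N-diagonal y = trans
      (cong₂ _xor_ (sum-cong-≗ λ w → ∧-idem (I y w)) (cong (_∧ not (D y xor D y)) (I-irrefl y)))
      (xor-identityʳ (degree y))

    private
      Coloured : Fin n → Fin n → Set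
      Coloured y z = Odd (interlaceCount X y z) ⇔ (Interlaced X y z × D y ≡ D z)

      same : Bool → Bool → Bool
      same a b = not (a xor b)

      same⇔ : ∀ a b → same a b ≡ true ⇔ a ≡ b
      same⇔ a b = mk⇔ (λ eq → xor≡false⇒≡ (not-injective eq)) λ { refl → cong not (xor-same a) }

      interlaced⇔ : ∀ y z → I y z ≡ true ⇔ Interlaced X y z
      interlaced⇔ y z = subst (λ b → b ≡ true ⇔ Interlaced X y z) (I≡ y z) (does⇔ (interlaced? X y z))

      both⇔ : ∀ y z → I y z ∧ same (D y) (D z) ≡ true ⇔ (Interlaced X y z × D y ≡ D z)
      both⇔ y z = mk⇔
        (λ eq → Equivalence.to (interlaced⇔ y z) (∧-conicalˡ _ _ eq) ,
                Equivalence.to (same⇔ _ _) (∧-conicalʳ (I y z) _ eq))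
        λ (p , q) → cong₂ _∧_ (Equivalence.from (interlaced⇔ y z) p) (Equivalence.from (same⇔ _ _) q)

      true⇔⇒≡ : ∀ {a b} → (a ≡ true → b ≡ true) → (b ≡ true → a ≡ true) → a ≡ b
      true⇔⇒≡ {true}          f g = sym (f refl)
      true⇔⇒≡ {false} {false} f g = refl
      true⇔⇒≡ {false} {true}  f g = g refl

      transpose : ∀ s d i → s xor d ≡ i → s xor i ≡ d
      transpose s d i refl = solve 2 (λ s d → s :+ (s :+ d) := d) refl s d

    -- `N y z` is `square y z` plus the indicator of being interlaced and equally coloured; the
    -- parity of the count is `square y z` plus the product of the degrees. Over GF(2) the indicator
    -- and the product may change places, which is `transpose`.
    coloured⇒rank-one : (∀ y z → Coloured y z) → ∀ y z → N y z ≡ degree y ∧ degree z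
    coloured⇒rank-one coloured y z = transpose (square y z) (degree y ∧ degree z) _ (trans (sym (odd-interlaceCount y z)) (true⇔⇒≡
      (Equivalence.from (both⇔ y z) ∘ Equivalence.to (coloured y z) ∘ Equivalence.from (Odd⇔odd (interlaceCount X y z)))
      (Equivalence.to (Odd⇔odd (interlaceCount X y z)) ∘ Equivalence.from (coloured y z) ∘ Equivalence.to (both⇔ y z))))

    rank-one⇒coloured : (∀ y z → N y z ≡ degree y ∧ degree z) → ∀ y z → Coloured y z
    rank-one⇒coloured rank y z = mk⇔
      (λ o → Equivalence.to (both⇔ y z) (trans (sym eq) (Equivalence.to (Odd⇔odd (interlaceCount X y z)) o)))
      (λ c → Equivalence.from (Odd⇔odd (interlaceCount X y z)) (trans eq (Equivalence.from (both⇔ y z) c)))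
      where
      eq : odd (interlaceCount X y z) ≡ I y z ∧ same (D y) (D z)
      eq = trans (odd-interlaceCount y z) (transpose (square y z) (I y z ∧ same (D y) (D z)) _ (rank y z))

-- With `2 * n` edges the right side says `n < faces`, the form in which connectivity is used in
-- both directions.
connectivity≤1⇔ : ∀ n edges faces →
  (+ 2 ℤ.- (+ n ℤ.- + edges ℤ.+ + faces)) ℤ.≤ + 1 ⇔ suc edges ℕ.≤ n ℕ.+ faces
connectivity≤1⇔ n edges faces = mk⇔
  (λ le → ℤₚ.drop‿+≤+ (ℤₚ.i-j≤0⇒i≤j (subst (ℤ._≤ + 0) balance (ℤₚ.i≤j⇒i-j≤0 le))))
  (λ le → ℤₚ.i-j≤0⇒i≤j (subst (ℤ._≤ + 0) (sym balance) (ℤₚ.i≤j⇒i-j≤0 (ℤ.+≤+ le))))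
  where
  balance : (+ 2 ℤ.- (+ n ℤ.- + edges ℤ.+ + faces)) ℤ.- + 1 ≡ + suc edges ℤ.- + (n ℕ.+ faces)
  balance = +-*-Solver.solve 3 (λ n k f →
      (S.con (+ 2) S.:- (n S.:- k S.:+ f)) S.:- S.con (+ 1) S.:= (S.con (+ 1) S.:+ k) S.:- (n S.:+ f))
    refl (+ n) (+ edges) (+ faces)
    where module S = +-*-Solver

-- From an embedding to a colouring

turn opposite : ∀ {n} → Dart n → Dart n
turn     (v , i) = v , next i
opposite (v , i) = v , next (next i)

next⁴ : ∀ (i : Fin 4) → next (next (next (next i))) ≡ i
next⁴ = toWitness {a? = all? λ i → next (next (next (next i))) ≟ i} _

Fin4-cyclic : ∀ (i j : Fin 4) → (j ≡ i ⊎ j ≡ next (next i)) ⊎ (j ≡ next i ⊎ j ≡ next (next (next i)))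
Fin4-cyclic = toWitness {a? = all? λ i → all? λ j →
  (j ≟ i ⊎-dec j ≟ next (next i)) ⊎-dec (j ≟ next i ⊎-dec j ≟ next (next (next i)))} _

opposite-involutive : ∀ {n} (d : Dart n) → opposite (opposite d) ≡ d
opposite-involutive (v , i) = cong (v ,_) (next⁴ i)

same-or-not : ∀ a b → a ≡ b ⊎ a ≡ not b
same-or-not true  true  = inj₁ refl
same-or-not true  false = inj₂ refl
same-or-not false true  = inj₂ refl
same-or-not false false = inj₁ refl

module EdgeEnds {n : ℕ} (R : RotationSystem n) where
  open RotationSystem R
  open Inverse ends using (to; from; strictlyInverseˡ; strictlyInverseʳ)

  to-injective : ∀ {d d′} → to d ≡ to d′ → d ≡ d′
  to-injective eq = trans (sym (strictlyInverseʳ _)) (trans (cong from eq) (strictlyInverseʳ _))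

  to-otherEnd : ∀ d → to (otherEnd d) ≡ (edge d , not (proj₂ (to d)))
  to-otherEnd d = strictlyInverseˡ _

  edge-otherEnd : ∀ d → edge (otherEnd d) ≡ edge d
  edge-otherEnd d = cong proj₁ (to-otherEnd d)

  otherEnd≢ : ∀ d → otherEnd d ≢ d
  otherEnd≢ d eq = not-¬ refl (sym (trans (sym (cong proj₂ (to-otherEnd d))) (cong (proj₂ ∘ to) eq)))

  same-edge : ∀ {d d′} → edge d ≡ edge d′ → d ≡ d′ ⊎ d ≡ otherEnd d′
  same-edge {d} {d′} eq with same-or-not (proj₂ (to d)) (proj₂ (to d′))
  ... | inj₁ e = inj₁ (to-injective (cong₂ _,_ eq e))
  ... | inj₂ e = inj₂ (to-injective (trans (cong₂ _,_ eq e) (sym (to-otherEnd d′))))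

  -- The GF(2)-valued functions that are constant on faces, expressed through the generators of
  -- `SameFace`. An embedding has `2 ^ faces` of them.
  Invariant : (Flag n → Bool) → Set
  Invariant φ = (∀ f → φ (corner f) ≡ φ f) × (∀ f → φ (alongEdge f) ≡ φ f)

module Necessity {n′ : ℕ} (X : GaussCode (suc n′)) (H : Embedding (suc n′))
                 (H-coloured : Embedding.TwoColourable H) (H-spells : Embedding.Spells H X) where

  open Embedding H
  open Code X
  open EdgeEnds rotationSystem

  private
    n m : ℕ
    n = suc n′
    m = 2 ℕ.* suc n′

    w : Fin m → Dart n
    w = proj₁ H-spells

    open IsOnlySmoothPath (proj₁ (proj₂ H-spells))

    w-at : ∀ i → proj₁ (w i) ≡ at i
    w-at = proj₂ (proj₂ H-spells)

    face-invariant : ∀ {A : Set} (b : Fin faces → A) f →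
      (b (face (corner f)) ≡ b (face f)) × (b (face (alongEdge f)) ≡ b (face f))
    face-invariant b f = cong b (sym (Equivalence.from (face-exact f _) (EqC.return (inj₁ refl))))
                       , cong b (sym (Equivalence.from (face-exact f _) (EqC.return (inj₂ refl))))

    col : Flag n → Bool
    col f = proj₁ H-coloured (face f)

    col-corner : ∀ f → col (corner f) ≡ col f
    col-corner f = proj₁ (face-invariant (proj₁ H-coloured) f)

    col-alongEdge : ∀ f → col (alongEdge f) ≡ col f
    col-alongEdge f = proj₂ (face-invariant (proj₁ H-coloured) f)

    c : Dart n → Bool
    c d = col (d , true)

    col-false : ∀ d → col (d , false) ≡ not (c d)
    col-false d = ¬-not (proj₂ H-coloured d ∘ sym)

    -- The side of `d` on which the face has colour `β`: the `true` side exactly if `c d ≡ β`.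
    side : Bool → Dart n → Bool
    side β d = not (β xor c d)

    side-unique : ∀ {β d s} → col (d , s) ≡ β → s ≡ side β d
    side-unique {d = d} {true}  refl = cong not (sym (xor-same (c d)))
    side-unique {d = d} {false} refl = sym (trans (cong (λ k → not (k xor c d)) (col-false d)) (lemma (c d)))
      where
      lemma : ∀ a → not (not a xor a) ≡ false
      lemma true  = refl
      lemma false = refl

    col-side : ∀ β d → col (d , side β d) ≡ β
    col-side β d with c d in eq | β
    ... | true  | true  = eq
    ... | true  | false = trans (col-false d) (cong not eq)
    ... | false | true  = trans (col-false d) (cong not eq)
    ... | false | false = eq

    -- `straight` is `opposite` after `otherEnd`, so smoothness read backwards identifies the dart
    -- through which visit `i` is entered.
    incoming : ∀ i → otherEnd (w (prev i)) ≡ opposite (w i)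
    incoming i = begin
      otherEnd (w (prev i))                          ≡⟨ opposite-involutive _ ⟨
      opposite (straight (w (prev i)))               ≡⟨ cong opposite (smooth (prev i)) ⟨
      opposite (w (next (prev i)))                   ≡⟨ cong (opposite ∘ w) (next-prev i) ⟩
      opposite (w i)                                 ∎
      where open ≡-Reasoning

    edge-injective : ∀ {i j} → edge (w i) ≡ edge (w j) → i ≡ j
    edge-injective {i} {j} eq with covers (edge (w j))
    ... | k , _ , unique = trans (sym (unique eq)) (unique refl)

    -- Otherwise `w j` is the end at which the edge of `w (prev i)` arrives. Since every edge is
    -- traversed once, `j` is `prev i`, and both ends of that edge would be the same dart.
    w-not-opposite : ∀ i j → w j ≢ opposite (w i)
    w-not-opposite i j eq = otherEnd≢ (w j) (begin
      otherEnd (w j)          ≡⟨ cong (otherEnd ∘ w) j≡prev ⟩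
      otherEnd (w (prev i))   ≡⟨ incoming i ⟩
      opposite (w i)          ≡⟨ eq ⟨
      w j                     ∎)
      where
      open ≡-Reasoning
      j≡prev : j ≡ prev i
      j≡prev = edge-injective (trans (cong edge (trans eq (sym (incoming i)))) (edge-otherEnd (w (prev i))))

    -- The second visit cannot leave by the dart that the first leaves by, as an edge would be
    -- traversed twice, nor by the one that the first enters by; it crosses the first transversally.
    crossing-darts : ∀ v → w (second v) ≡ turn (w (first v)) ⊎ w (second v) ≡ opposite (turn (w (first v)))
    crossing-darts v = go (Fin4-cyclic (proj₂ (w (first v))) (proj₂ (w (second v))))
      where
      same-vertex : proj₁ (w (second v)) ≡ proj₁ (w (first v))
      same-vertex = begin
        proj₁ (w (second v))   ≡⟨ w-at (second v) ⟩
        at (second v)          ≡⟨ at-second v ⟩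
        v                      ≡⟨ at-first v ⟨
        at (first v)           ≡⟨ w-at (first v) ⟨
        proj₁ (w (first v))    ∎
        where open ≡-Reasoning

      go : _ → _
      go (inj₁ (inj₁ eq)) = contradiction (edge-injective (cong edge (cong₂ _,_ same-vertex eq)))
                                          (first≢second v ∘ sym)
      go (inj₁ (inj₂ eq)) = contradiction (cong₂ _,_ same-vertex eq) (w-not-opposite (first v) (second v))
      go (inj₂ (inj₁ eq)) = inj₁ (cong₂ _,_ same-vertex eq)
      go (inj₂ (inj₂ eq)) = inj₂ (cong₂ _,_ same-vertex eq)

    c-turn : ∀ d → c (turn d) ≡ not (c d)
    c-turn d = trans (sym (not-involutive _))
      (cong not (trans (sym (col-false (turn d))) (col-corner (d , true))))

    h : (Flag n → Bool) → Bool → Dart n → Bool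
    h φ β d = φ (d , side β d)

    -- The restriction of `φ` to the faces of colour `β`, read along the walk: `i` stands for the
    -- edge leaving visit `i` and `prev i` for the edge entering it.
    g : (Flag n → Bool) → Bool → Fin m → Bool
    g φ β i = h φ β (w i)

    -- Corners of colour `δ` at `v` join the two outgoing ends and the two incoming ends; corners of
    -- colour `ε` join an outgoing end to the incoming end of the other visit.
    Joins : (Flag n → Bool) → Fin n → Bool → Bool → Set
    Joins φ v δ ε = (g φ δ (first v) ≡ g φ δ (second v)        × g φ δ (prev (first v)) ≡ g φ δ (prev (second v)))
                  × (g φ ε (first v) ≡ g φ ε (prev (second v)) × g φ ε (prev (first v)) ≡ g φ ε (second v))

    module _ (φ : Flag n → Bool) (φ-inv : Invariant φ) where

      h-otherEnd : ∀ β d → h φ β (otherEnd d) ≡ h φ β d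
      h-otherEnd β d = trans
        (cong (λ s → φ (otherEnd d , s)) (sym (side-unique (trans (col-alongEdge (d , side β d)) (col-side β d)))))
        (proj₂ φ-inv (d , side β d))

      g-prev : ∀ β i → g φ β (prev i) ≡ h φ β (opposite (w i))
      g-prev β i = trans (sym (h-otherEnd β (w (prev i)))) (cong (h φ β) (incoming i))

      -- The corner between `d` and `turn d` lies on the `true` side of `d`, so its colour is `c d`.
      h-turn : ∀ {β} d → c d ≡ β → h φ β d ≡ h φ β (turn d)
      h-turn d refl = begin
        φ (d , side (c d) d)              ≡⟨ cong (λ s → φ (d , s)) (side-unique refl) ⟨
        φ (d , true)                      ≡⟨ proj₁ φ-inv (d , true) ⟨
        φ (turn d , false)                ≡⟨ cong (λ s → φ (turn d , s)) (side-unique (col-corner (d , true))) ⟩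
        φ (turn d , side (c d) (turn d))  ∎
        where open ≡-Reasoning

      -- The four corners at a vertex alternate in colour, so the two corners of either colour pair
      -- up the four darts.
      around : ∀ d → (h φ (c d) d ≡ h φ (c d) (turn d) × h φ (c d) (opposite d) ≡ h φ (c d) (opposite (turn d)))
                   × (h φ (not (c d)) d ≡ h φ (not (c d)) (opposite (turn d)) ×
                      h φ (not (c d)) (opposite d) ≡ h φ (not (c d)) (turn d))
      around d = (h-turn d refl , h-turn (opposite d) c-opposite)
               , (trans (cong (h φ (not (c d))) (sym (opposite-involutive d)))
                        (sym (h-turn (turn (opposite d)) (trans (c-turn (opposite d)) (cong not c-opposite))))
                 , sym (h-turn (turn d) (c-turn d)))
        where
        c-opposite : c (opposite d) ≡ c d
        c-opposite = trans (c-turn (turn d)) (trans (cong not (c-turn d)) (not-involutive (c d)))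

      joins-turn : ∀ {v} → w (second v) ≡ turn (w (first v)) → Joins φ v (c (w (first v))) (not (c (w (first v))))
      joins-turn {v} eq with around (w (first v))
      ... | (p , q) , (r , s) =
          (trans p (at-turn γ) , trans (g-prev γ _) (trans q (at-opposite-turn γ)))
        , (trans r (at-opposite-turn (not γ)) , trans (g-prev (not γ) _) (trans s (at-turn (not γ))))
        where
        γ : Bool
        γ = c (w (first v))

        at-turn : ∀ β → h φ β (turn (w (first v))) ≡ g φ β (second v)
        at-turn β = cong (h φ β) (sym eq)

        at-opposite-turn : ∀ β → h φ β (opposite (turn (w (first v)))) ≡ g φ β (prev (second v))
        at-opposite-turn β = trans (cong (h φ β ∘ opposite) (sym eq)) (sym (g-prev β (second v)))

      joins-opposite-turn : ∀ {v} → w (second v) ≡ opposite (turn (w (first v))) →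
                            Joins φ v (not (c (w (first v)))) (c (w (first v)))
      joins-opposite-turn {v} eq with around (w (first v))
      ... | (p , q) , (r , s) =
          (trans r (at-opposite-turn (not γ)) , trans (g-prev (not γ) _) (trans s (at-turn (not γ))))
        , (trans p (at-turn γ) , trans (g-prev γ _) (trans q (at-opposite-turn γ)))
        where
        γ : Bool
        γ = c (w (first v))

        at-turn : ∀ β → h φ β (turn (w (first v))) ≡ g φ β (prev (second v))
        at-turn β = trans (cong (h φ β) (sym (trans (cong opposite eq) (opposite-involutive _))))
                          (sym (g-prev β (second v)))

        at-opposite-turn : ∀ β → h φ β (opposite (turn (w (first v)))) ≡ g φ β (second v)
        at-opposite-turn β = cong (h φ β) (sym eq)

    opaque
      -- The bit is chosen before `φ`: it is the colour of the corner between the two outgoing ends,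
      -- which depends only on whether the second outgoing dart follows or precedes the first in the
      -- rotation.
      transition : ∀ v → Σ[ δ ∈ Bool ] (∀ φ → Invariant φ → Joins φ v δ (not δ))
      transition v with crossing-darts v
      ... | inj₁ eq = c (w (first v)) , λ φ inv → joins-turn φ inv {v} eq
      ... | inj₂ eq = not (c (w (first v))) , λ φ inv →
            subst (Joins φ v (not (c (w (first v))))) (sym (not-involutive (c (w (first v))))) (joins-opposite-turn φ inv {v} eq)

  diagonal : Fin n → Bool
  diagonal v = proj₁ (transition v)

  open Quadratic I I-sym diagonal

  private
    x : (Flag n → Bool) → Bool → Fin n → Bool
    x φ β v = g φ β (first v) xor g φ β (prev (first v))

    last : Fin m
    last = fromℕ _

    module _ (φ : Flag n → Bool) (φ-inv : Invariant φ) where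

      -- The corners match the pair of values at one visit with the pair at the other, in the same
      -- order for one colour and swapped for the other; their sum is unaffected.
      derivative-second : ∀ β v → g φ β (second v) xor g φ β (prev (second v)) ≡ x φ β v
      derivative-second β v with proj₂ (transition v) φ φ-inv | same-or-not β (diagonal v)
      ... | (p , q) , _ | inj₁ refl = cong₂ _xor_ (sym p) (sym q)
      ... | _ , (p , q) | inj₂ refl = trans (cong₂ _xor_ (sym q) (sym p)) (xor-comm (g φ (not (diagonal v)) (prev (first v))) _)

      derivative : ∀ β i → g φ β i xor g φ β (prev i) ≡ x φ β (at i)
      derivative β i with occurs {at i} {i} refl
      ... | inj₁ eq = cong (λ k → g φ β k xor g φ β (prev k)) eq
      ... | inj₂ eq = trans (cong (λ k → g φ β k xor g φ β (prev k)) eq) (derivative-second β (at i))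

      g-antiderivative : ∀ β i → g φ β i ≡ g φ β last xor prefixSum (x φ β ∘ at) i
      g-antiderivative β = cyclic-antiderivative (x φ β ∘ at) (g φ β) λ i → begin
        g φ β (next i)                                         ≡⟨ shift (g φ β i) (g φ β (next i)) ⟩
        g φ β i xor (g φ β (next i) xor g φ β i)               ≡⟨ cong (λ k → g φ β i xor (g φ β (next i) xor g φ β k)) (prev-next i) ⟨
        g φ β i xor (g φ β (next i) xor g φ β (prev (next i))) ≡⟨ cong (g φ β i xor_) (derivative β (next i)) ⟩
        g φ β i xor x φ β (at (next i))                        ∎
        where
        open ≡-Reasoning
        shift : ∀ a b → b ≡ a xor (b xor a)
        shift = solve 2 (λ a b → b := a :+ (b :+ a)) refl

      across : ∀ β v → g φ β (first v) xor g φ β (second v) ≡ x φ β v xor (I · x φ β) v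
      across β v = trans (cong₂ _xor_ (g-antiderivative β (first v)) (g-antiderivative β (second v)))
        (trans (cancel (g φ β last) (prefixSum (x φ β ∘ at) (first v)) (prefixSum (x φ β ∘ at) (second v)))
               (prefixSum-between (x φ β) v))
        where
        cancel : ∀ a p q → (a xor p) xor (a xor q) ≡ p xor q
        cancel = solve 3 (λ a p q → (a :+ p) :+ (a :+ q) := p :+ q) refl

      -- If `β` is `diagonal v`, the outgoing values agree and `across` gives `I x = x` at `v`.
      -- Otherwise the first outgoing value equals the second incoming one, so the outgoing values
      -- differ by the jump itself and `I x` vanishes at `v`.
      kernel : ∀ β v → (I · x φ β) v ≡ not (β xor diagonal v) ∧ x φ β v
      kernel β v with proj₂ (transition v) φ φ-inv | same-or-not β (diagonal v)
      ... | (p , _) , _ | inj₁ refl = trans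
        (sym (xor≡false⇒≡ (trans (sym (across β v))
          (trans (cong (_xor g φ β (second v)) p) (xor-same (g φ β (second v)))))))
        (cong (λ k → not k ∧ x φ β v) (sym (xor-same (diagonal v))))
      ... | _ , (p , _) | inj₂ refl = trans
        (cancel (trans (sym (across β v)) (trans (xor-comm (g φ β (first v)) _)
           (trans (cong (g φ β (second v) xor_) p) (derivative-second β v)))))
        (cong (λ k → not k ∧ x φ β v) (sym (xor-inverseˡ (diagonal v))))
        where
        cancel : ∀ {a b} → a xor b ≡ a → b ≡ false
        cancel {true}  {false} _ = refl
        cancel {false} {false} _ = refl

      kernel-true : ∀ v → M (x φ true) v ≡ false
      kernel-true v = trans (cong (_xor diagonal v ∧ x φ true v) (kernel true v))
        (trans (cong (λ k → k ∧ x φ true v xor diagonal v ∧ x φ true v) (not-involutive (diagonal v)))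
               (xor-same (diagonal v ∧ x φ true v)))

      kernel-false : M (x φ false) ≗ x φ false
      kernel-false v = trans (cong (_xor diagonal v ∧ x φ false v) (kernel false v))
                             (complement (diagonal v) (x φ false v))
        where
        complement : ∀ d a → not d ∧ a xor d ∧ a ≡ a
        complement true  a = refl
        complement false a = xor-identityʳ a

    -- The walk covers every edge, so both functions `g φ β` together determine `φ`, and each is
    -- fixed by its jumps and its value at `last`.
    reconstruct : ∀ φ ψ → Invariant φ → Invariant ψ →
      (∀ β → g φ β last ≡ g ψ β last) → (∀ β → x φ β ≗ x ψ β) → φ ≗ ψ
    reconstruct φ ψ φ-inv ψ-inv lasts xs (d , s) = begin
      φ (d , s)             ≡⟨ cong (λ s → φ (d , s)) (side-unique {d = d} refl) ⟩
      h φ (col (d , s)) d   ≡⟨ h-agree (col (d , s)) ⟩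
      h ψ (col (d , s)) d   ≡⟨ cong (λ s → ψ (d , s)) (side-unique {d = d} refl) ⟨
      ψ (d , s)             ∎
      where
      open ≡-Reasoning

      g-agree : ∀ β i → g φ β i ≡ g ψ β i
      g-agree β i = begin
        g φ β i                                     ≡⟨ g-antiderivative φ φ-inv β i ⟩
        g φ β last xor prefixSum (x φ β ∘ at) i     ≡⟨ cong₂ _xor_ (lasts β) (sum-cong-≗ λ j → cong ((j ≤ᵇ i) ∧_) (xs β (at j))) ⟩
        g ψ β last xor prefixSum (x ψ β ∘ at) i     ≡⟨ g-antiderivative ψ ψ-inv β i ⟨
        g ψ β i                                     ∎

      h-agree : ∀ β → h φ β d ≡ h ψ β d
      h-agree β with covers (edge d)
      ... | i , eq , _ with same-edge {d} {w i} (sym eq)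
      ...   | inj₁ refl = g-agree β i
      ...   | inj₂ refl = trans (h-otherEnd φ φ-inv β (w i)) (trans (g-agree β i) (sym (h-otherEnd ψ ψ-inv β (w i))))

    -- If columns y and z of N are independent, the span of e y and e z meets ker N
    -- trivially, so N recovers the two constants of φ from this sum.
    vector : (y z : Fin n) → (Flag n → Bool) → Fin n → Bool
    vector y z φ = (x φ true ⊕ x φ false) ⊕ (g φ true last ⊛ e y ⊕ g φ false last ⊛ e z)

    N-vector : ∀ y z φ → Invariant φ → ∀ v →
      (N · vector y z φ) v ≡ g φ true last ∧ N v y xor g φ false last ∧ N v z
    N-vector y z φ φ-inv v = begin
      (N · vector y z φ) v
        ≡⟨ ·-⊕ N (x φ true ⊕ x φ false) (g φ true last ⊛ e y ⊕ g φ false last ⊛ e z) v ⟩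
      (N · (x φ true ⊕ x φ false)) v xor (N · (g φ true last ⊛ e y ⊕ g φ false last ⊛ e z)) v
        ≡⟨ cong₂ _xor_ (N-kernel (kernel-true φ φ-inv) (kernel-false φ φ-inv) v)
                       (·-⊕ N (g φ true last ⊛ e y) (g φ false last ⊛ e z) v) ⟩
      (N · (g φ true last ⊛ e y)) v xor (N · (g φ false last ⊛ e z)) v
        ≡⟨ cong₂ _xor_ (·-scaled-basis N _ y v) (·-scaled-basis N _ z v) ⟩
      g φ true last ∧ N v y xor g φ false last ∧ N v z
        ∎
      where open ≡-Reasoning

    module _ {y z r₁ r₂ r₃} (N₁ : N r₁ y ≡ true) (N₂ : N r₂ z ≡ true) (N₃ : N r₃ y ≢ N r₃ z) where

      independent : ∀ {s t s′ t′} →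
        (∀ v → s ∧ N v y xor t ∧ N v z ≡ s′ ∧ N v y xor t′ ∧ N v z) → s ≡ s′ × t ≡ t′
      independent {s} {t} {s′} {t′} eq =
        let p , q = vanish (s xor s′) (t xor t′) λ v →
              trans (split s t s′ t′ (N v y) (N v z)) (trans (cong (_xor _) (eq v)) (xor-same (s′ ∧ N v y xor t′ ∧ N v z)))
        in xor≡false⇒≡ p , xor≡false⇒≡ q
        where
        split : ∀ s t s′ t′ p q → (s xor s′) ∧ p xor (t xor t′) ∧ q ≡
                                  (s ∧ p xor t ∧ q) xor (s′ ∧ p xor t′ ∧ q)
        split = solve 6 (λ s t s′ t′ p q → (s :+ s′) :* p :+ (t :+ t′) :* q :=
                                           (s :* p :+ t :* q) :+ (s′ :* p :+ t′ :* q)) refl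

        vanish : ∀ a b → (∀ v → a ∧ N v y xor b ∧ N v z ≡ false) → a ≡ false × b ≡ false
        vanish false false _  = refl , refl
        vanish true  true  eq = contradiction (xor≡false⇒≡ (eq r₃)) N₃
        vanish true  false eq = contradiction (trans (sym N₁) (trans (sym (xor-identityʳ _)) (eq r₁))) λ ()
        vanish false true  eq = contradiction (trans (sym N₂) (eq r₂)) λ ()

      -- `N` recovers the two constants; removing them leaves `x φ true ⊕ x φ false`, and `M`
      -- extracts the second summand from this.
      vector-injective : ∀ φ ψ → Invariant φ → Invariant ψ → vector y z φ ≗ vector y z ψ → φ ≗ ψ
      vector-injective φ ψ φ-inv ψ-inv eq = reconstruct φ ψ φ-inv ψ-inv lasts xs
        where
        bits : g φ true last ≡ g ψ true last × g φ false last ≡ g ψ false last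
        bits = independent λ v → trans (sym (N-vector y z φ φ-inv v)) (trans (·-cong N eq v) (N-vector y z ψ ψ-inv v))

        lasts : ∀ β → g φ β last ≡ g ψ β last
        lasts true  = proj₁ bits
        lasts false = proj₂ bits

        xor-cancelʳ : ∀ {a b a′ b′} → a xor b ≡ a′ xor b′ → b ≡ b′ → a ≡ a′
        xor-cancelʳ {a} {b} {a′} p refl = trans (sym (restore a b)) (trans (cong (_xor b) p) (restore a′ b))
          where
          restore : ∀ a b → (a xor b) xor b ≡ a
          restore = solve 2 (λ a b → (a :+ b) :+ b := a) refl

        sums : x φ true ⊕ x φ false ≗ x ψ true ⊕ x ψ false
        sums v = xor-cancelʳ (eq v)
          (cong₂ (λ s t → s ∧ e y v xor t ∧ e z v) (proj₁ bits) (proj₂ bits))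

        M-vector : ∀ χ → Invariant χ → M (x χ true ⊕ x χ false) ≗ x χ false
        M-vector χ χ-inv v = trans (M-⊕ (x χ true) (x χ false) v)
          (cong₂ _xor_ (kernel-true χ χ-inv v) (kernel-false χ χ-inv v))

        xᶠ : x φ false ≗ x ψ false
        xᶠ v = trans (sym (M-vector φ φ-inv v)) (trans (M-cong sums v) (M-vector ψ ψ-inv v))

        xs : ∀ β → x φ β ≗ x ψ β
        xs true  v = xor-cancelʳ (sums v) (xᶠ v)
        xs false   = xᶠ

      -- Each of the `2 ^ faces` Boolean labellings of the faces gives an invariant function, and
      -- `vector` encodes it in `n` bits without loss.
      faces≤n : faces ℕ.≤ n
      faces≤n = cube-injection⇒≤ (λ b → vector y z (b ∘ face)) λ {b} {b′} eq j →
        let f , face-f = face-surjective j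
        in trans (cong b (sym face-f))
             (trans (vector-injective (b ∘ face) (b′ ∘ face)
                      ((λ f → proj₁ (face-invariant b f)) , λ f → proj₂ (face-invariant b f))
                      ((λ f → proj₁ (face-invariant b′ f)) , λ f → proj₂ (face-invariant b′ f)) eq f)
                    (cong b′ face-f))

    2n≤edges : m ℕ.≤ edges
    2n≤edges = injective⇒≤ edge-injective

  -- Connectivity at most 1 and at least `2 * n` edges force `n < faces`, against the bound that two
  -- independent columns of `N` would give.
  rank-one-diagonal : connectivity ℤ.≤ + 1 → ∀ y z → N y z ≡ N y y ∧ N z z
  rank-one-diagonal le = rank-one λ N₁ N₂ N₃ → ℕₚ.<⇒≱ n<faces (faces≤n N₁ N₂ N₃)
    where
    open ℕₚ.≤-Reasoning
    n<faces : n ℕ.< faces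
    n<faces = ℕₚ.+-cancelˡ-≤ n (suc n) faces (begin
      n ℕ.+ suc n        ≡⟨ ℕₚ.+-suc n n ⟩
      suc (n ℕ.+ n)      ≡⟨ cong (λ k → suc (n ℕ.+ k)) (ℕₚ.+-identityʳ n) ⟨
      suc m              ≤⟨ ℕ.s≤s 2n≤edges ⟩
      suc edges          ≤⟨ Equivalence.to (connectivity≤1⇔ n edges faces) le ⟩
      n ℕ.+ faces        ∎)

-- From a colouring to an embedding

-- One equation costs at most one dimension: the coordinate at the first true coefficient is solved
-- for, the others stay free. If no coefficient before the last is true, the last coordinate is set
-- to `false`.
hyperplane : ∀ {k} (u : Fin (suc k) → Bool) →
  Σ[ embed ∈ ((Fin k → Bool) → Fin (suc k) → Bool) ]
    ((∀ t → ∑[ i < suc k ] (u i ∧ embed t i) ≡ false) × (∀ {s t} → embed s ≗ embed t → s ≗ t))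
hyperplane {zero} u = (λ _ _ → false) , (λ _ → trans (xor-identityʳ _) (∧-zeroʳ (u zero))) , λ _ ()
hyperplane {suc k} u with u zero in u₀
... | true = (λ t → ∑[ i < suc k ] (u (suc i) ∧ t i) ∷ᶠ t)
           , (λ t → xor-same (∑[ i < suc k ] (u (suc i) ∧ t i)))
           , λ eq → eq ∘ suc
... | false with hyperplane (u ∘ suc)
...   | embed , in-hyperplane , injective =
          (λ t → t zero ∷ᶠ embed (t ∘ suc))
        , (λ t → in-hyperplane (t ∘ suc))
        , λ where
            eq zero    → eq zero
            eq (suc i) → injective (eq ∘ suc) i

Flag↔Fin : ∀ n → Flag n ↔ Fin (n ℕ.* 4 ℕ.* 2)
Flag↔Fin n = ↔-sym (↔-trans *↔× (*↔× ×-↔ 2↔Bool))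

module _ {n : ℕ} (R : RotationSystem n) where
  open RotationSystem R
  open EdgeEnds R

  invariant-on-faces : ∀ {φ} → Invariant φ → ∀ {f f′} → SameFace f f′ → φ f ≡ φ f′
  invariant-on-faces {φ} (φ-corner , φ-along) = EqC.gfold isEquivalence φ λ where
    (inj₁ refl) → sym (φ-corner _)
    (inj₂ refl) → sym (φ-along _)

  corner-involutive : ∀ f → corner (corner f) ≡ f
  corner-involutive ((v , i) , true)  = cong (λ j → (v , j) , true) (prev-next i)
  corner-involutive ((v , i) , false) = cong (λ j → (v , j) , false) (next-prev i)

module Sufficiency {n′ : ℕ} (X : GaussCode (suc n′)) (D : Fin (suc n′) → Bool) where
  open Code X
  open Criterion X
  open Quadratic I I-sym D

  private
    n m : ℕ
    n = suc n′
    m = 2 ℕ.* suc n′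

  w : Fin m → Dart n
  w i = at i , (if does (i ≟ first (at i)) then 0F else 1F)

  w-first : ∀ v → w (first v) ≡ (v , 0F)
  w-first v = cong₂ _,_ (at-first v) (cong (if_then 0F else 1F)
    (dec-true (first v ≟ first (at (first v))) (cong first (sym (at-first v)))))

  w-second : ∀ v → w (second v) ≡ (v , 1F)
  w-second v = cong₂ _,_ (at-second v) (cong (if_then 0F else 1F)
    (dec-false (second v ≟ first (at (second v)))
      (λ eq → first≢second v (sym (trans eq (cong first (at-second v)))))))

  -- The rotation at v: out at the first visit, out at the second, in at the
  -- first, in at the second; edge i joins the positions i (true) and next i (false).
  slot : Fin n → Fin 4 → Fin m × Bool
  slot v 0F = first v         , true
  slot v 1F = second v        , true
  slot v 2F = prev (first v)  , false
  slot v 3F = prev (second v) , false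

  dart : Fin m × Bool → Dart n
  dart (i , true)  = w i
  dart (i , false) = opposite (w (next i))

  dart-slot : ∀ v k → dart (slot v k) ≡ (v , k)
  dart-slot v 0F = w-first v
  dart-slot v 1F = w-second v
  dart-slot v 2F = cong opposite (trans (cong w (next-prev (first v))) (w-first v))
  dart-slot v 3F = cong opposite (trans (cong w (next-prev (second v))) (w-second v))

  slotOf : Dart n → Fin m × Bool
  slotOf (v , k) = slot v k

  slot-w : ∀ i → slotOf (w i) ≡ (i , true)
  slot-w i with occurs {at i} {i} refl
  ... | inj₁ eq = trans (cong (slotOf ∘ w) eq) (trans (cong slotOf (w-first (at i))) (cong (_, true) (sym eq)))
  ... | inj₂ eq = trans (cong (slotOf ∘ w) eq) (trans (cong slotOf (w-second (at i))) (cong (_, true) (sym eq)))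

  slot-opposite-w : ∀ i → slotOf (opposite (w i)) ≡ (prev i , false)
  slot-opposite-w i with occurs {at i} {i} refl
  ... | inj₁ eq = trans (cong (slotOf ∘ opposite ∘ w) eq)
                        (trans (cong (slotOf ∘ opposite) (w-first (at i))) (cong (λ j → prev j , false) (sym eq)))
  ... | inj₂ eq = trans (cong (slotOf ∘ opposite ∘ w) eq)
                        (trans (cong (slotOf ∘ opposite) (w-second (at i))) (cong (λ j → prev j , false) (sym eq)))

  slot-dart : ∀ e → slotOf (dart e) ≡ e
  slot-dart (i , true)  = slot-w i
  slot-dart (i , false) = trans (slot-opposite-w (next i)) (cong (_, false) (prev-next i))

  -- The colour prescribed for the corner between a dart and the next one. The corner from `0F` to
  -- `1F` joins the two outgoing ends and receives `D v`; the colours then alternate.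
  c : Dart n → Bool
  c (v , 0F) = D v
  c (v , 1F) = not (D v)
  c (v , 2F) = D v
  c (v , 3F) = not (D v)

  c-opposite : ∀ d → c (opposite d) ≡ c d
  c-opposite (v , 0F) = refl
  c-opposite (v , 1F) = refl
  c-opposite (v , 2F) = refl
  c-opposite (v , 3F) = refl

  c-turn : ∀ d → c (turn d) ≡ not (c d)
  c-turn (v , 0F) = refl
  c-turn (v , 1F) = sym (not-involutive (D v))
  c-turn (v , 2F) = refl
  c-turn (v , 3F) = sym (not-involutive (D v))

  rotation : RotationSystem n
  rotation = record
    { edges   = m
    ; ends    = mk↔ₛ′ slotOf dart slot-dart (λ (v , k) → dart-slot v k)
    -- The only signature for which the colours of the sides agree along edges.
    ; twisted = λ i → not (c (w i) xor c (w (next i)))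
    }

  open RotationSystem rotation using (edge; otherEnd; straight; corner; alongEdge; twisted; SameFace)
  open EdgeEnds rotation

  otherEnd-dart : ∀ i b → otherEnd (dart (i , b)) ≡ dart (i , not b)
  otherEnd-dart i b = cong (λ (j , s) → dart (j , not s)) (slot-dart (i , b))

  -- The signature mentions `w (next i)`, while the far end of edge `i` is its opposite; both have
  -- the same `c`, and the formula is symmetric in the two ends.
  twisted-edge : ∀ d → twisted (edge d) ≡ not (c d xor c (otherEnd d))
  twisted-edge (v , k) = subst (λ d → twisted (edge d) ≡ not (c d xor c (otherEnd d))) (dart-slot v k) (go (slot v k))
    where
    go : ∀ e → twisted (edge (dart e)) ≡ not (c (dart e) xor c (otherEnd (dart e)))
    go (i , true)  = trans (cong (twisted ∘ proj₁) (slot-dart (i , true))) (cong (λ k → not (c (w i) xor k))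
      (trans (sym (c-opposite (w (next i)))) (cong c (sym (otherEnd-dart i true)))))
    go (i , false) = trans (cong (twisted ∘ proj₁) (slot-dart (i , false)))
      (cong not (trans (xor-comm (c (w i)) (c (w (next i))))
        (cong₂ _xor_ (sym (c-opposite (w (next i)))) (cong c (sym (otherEnd-dart i false))))))

  -- This is `c d` on the `true` side and its negation on the `false` side, so that the two sides of
  -- an edge differ by construction.
  col : Flag n → Bool
  col (d , s) = not (s xor c d)

  col-corner : ∀ f → col (corner f) ≡ col f
  col-corner (d , true)  = cong not (c-turn d)
  col-corner ((v , k) , false) = cong not (begin
    not (c (v , prev k))     ≡⟨ c-turn (v , prev k) ⟨
    c (v , next (prev k))    ≡⟨ cong (λ k → c (v , k)) (next-prev k) ⟩
    c (v , k)                ∎)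
    where open ≡-Reasoning

  col-alongEdge : ∀ f → col (alongEdge f) ≡ col f
  col-alongEdge (d , s) = trans
    (cong (λ t → not ((if t then s else not s) xor c (otherEnd d))) (twisted-edge d))
    (go s (c d) (c (otherEnd d)))
    where
    go : ∀ s a b → not ((if not (a xor b) then s else not s) xor b) ≡ not (s xor a)
    go true  true  true  = refl
    go true  true  false = refl
    go true  false true  = refl
    go true  false false = refl
    go false true  true  = refl
    go false true  false = refl
    go false false true  = refl
    go false false false = refl

  col-surjective : ∀ β d → col (d , not (β xor c d)) ≡ β
  col-surjective β d with β | c d
  ... | true  | true  = refl
  ... | true  | false = refl
  ... | false | true  = refl
  ... | false | false = refl

  quotient : FiniteQuotient (RotationSystem.BoundaryStep rotation)
  quotient = functionalQuotient (Flag↔Fin n) corner alongEdge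

  H : Embedding n
  H = record
    { rotationSystem  = rotation
    ; faces           = proj₁ quotient
    ; face            = proj₁ (proj₂ quotient)
    ; face-surjective = proj₁ (proj₂ (proj₂ quotient))
    ; face-exact      = proj₂ (proj₂ (proj₂ quotient))
    }

  open Embedding H using (faces; face; face-surjective; face-exact)

  representative : Fin faces → Flag n
  representative j = proj₁ (face-surjective j)

  on-representative : ∀ {φ} → Invariant φ → ∀ f → φ (representative (face f)) ≡ φ f
  on-representative inv f = invariant-on-faces rotation inv
    (Equivalence.to (face-exact _ f) (proj₂ (face-surjective (face f))))

  twoColourable : Embedding.TwoColourable H
  twoColourable = col ∘ representative , λ d eq →
    not-¬ {c d} refl (not-injective (begin
      not (c d)                                ≡⟨ on-col (d , false) ⟨
      col (representative (face (d , false)))  ≡⟨ eq ⟨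
      col (representative (face (d , true)))   ≡⟨ on-col (d , true) ⟩
      not (not (c d))                          ∎))
    where
    open ≡-Reasoning
    on-col : ∀ f → col (representative (face f)) ≡ col f
    on-col = on-representative (col-corner , col-alongEdge)

  spells : Embedding.Spells H X
  spells = w , record
    { smooth = λ i → sym (trans (cong opposite (otherEnd-dart i true)) (opposite-involutive (w (next i))))
    ; covers = λ i → i , cong proj₁ (slot-w i) , λ {j} eq → trans (sym eq) (cong proj₁ (slot-w j))
    } , λ i → refl

  private
    cancel : ∀ a p q → p xor q ≡ (a xor p) xor (a xor q)
    cancel = solve 3 (λ a p q → p :+ q := (a :+ p) :+ (a :+ q)) refl

  -- The passage from functions on faces to kernel vectors, reversed: by `rank` a vector orthogonal
  -- to `degree` lies in the kernel of `N`, and together with the constants `b` it yields an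
  -- invariant function `φ`.
  module KernelVector
    (rank : ∀ y z → N y z ≡ degree y ∧ degree z)
    (b : Bool → Bool) (z : Fin n → Bool) (z-even : ∑[ v < n ] (degree v ∧ z v) ≡ false) where

    -- The components of z in ker (M² + M) = ker M ⊕ ker (M + 1).
    x : Bool → Fin n → Bool
    x true  = M z ⊕ z
    x false = M z

    M²z : M (M z) ≗ M z
    M²z v = xor≡false⇒≡ (begin
      M (M z) v xor M z v                          ≡⟨ N≗M²⊕M z v ⟨
      ∑[ t < n ] (N v t ∧ z t)                     ≡⟨ sum-cong-≗ (λ t → trans (cong (_∧ z t) (rank v t)) (∧-assoc (degree v) (degree t) (z t))) ⟩
      ∑[ t < n ] (degree v ∧ (degree t ∧ z t))     ≡⟨ *-distribˡ-sum (degree v) (λ t → degree t ∧ z t) ⟨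
      degree v ∧ ∑[ t < n ] (degree t ∧ z t)       ≡⟨ cong (degree v ∧_) z-even ⟩
      degree v ∧ false                             ≡⟨ ∧-zeroʳ (degree v) ⟩
      false                                        ∎)
      where open ≡-Reasoning

    kernel : ∀ β v → (I · x β) v ≡ not (β xor D v) ∧ x β v
    kernel true v = trans (xor≡false⇒≡ (begin
      M (M z ⊕ z) v          ≡⟨ M-⊕ (M z) z v ⟩
      M (M z) v xor M z v    ≡⟨ cong (_xor M z v) (M²z v) ⟩
      M z v xor M z v        ≡⟨ xor-same (M z v) ⟩
      false                  ∎)) (cong (_∧ x true v) (sym (not-involutive (D v))))
      where open ≡-Reasoning
    kernel false v = trans (move ((I · M z) v) (D v ∧ M z v)) (trans (cong (_xor D v ∧ M z v) (M²z v)) (complement (D v) (M z v)))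
      where
      move : ∀ p q → p ≡ (p xor q) xor q
      move = solve 2 (λ p q → p := (p :+ q) :+ q) refl
      complement : ∀ d a → a xor d ∧ a ≡ not d ∧ a
      complement true  a = xor-same a
      complement false a = xor-identityʳ a

    g : Bool → Fin m → Bool
    g β i = b β xor prefixSum (x β ∘ at) i

    g-prev : ∀ β i → g β (prev i) ≡ g β i xor x β (at i)
    g-prev β i = sym (begin
      (b β xor P i) xor y i                          ≡⟨ cong (λ j → (b β xor P j) xor y j) (next-prev i) ⟨
      (b β xor P (next (prev i))) xor y (next (prev i))
        ≡⟨ cong (λ p → (b β xor p) xor y (next (prev i))) (prefixSum-next y (sum-at≡false (x β)) (prev i)) ⟩
      (b β xor (P (prev i) xor y (next (prev i)))) xor y (next (prev i))
        ≡⟨ undo (b β) (P (prev i)) (y (next (prev i))) ⟩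
      b β xor P (prev i)                             ∎)
      where
      open ≡-Reasoning
      y P : Fin m → Bool
      y = x β ∘ at
      P = prefixSum y
      undo : ∀ b p y → (b xor (p xor y)) xor y ≡ b xor p
      undo = solve 3 (λ b p y → (b :+ (p :+ y)) :+ y := b :+ p) refl

    g-last : ∀ β → g β (fromℕ _) ≡ b β
    g-last β = trans (cong (b β xor_) (trans (prefixSum-fromℕ (x β ∘ at)) (sum-at≡false (x β)))) (xor-identityʳ (b β))

    across : ∀ β v → g β (first v) xor g β (second v) ≡ x β v xor (I · x β) v
    across β v = trans (sym (cancel (b β) (prefixSum (x β ∘ at) (first v)) (prefixSum (x β ∘ at) (second v)))) (prefixSum-between (x β) v)

    g-prev-first : ∀ β v → g β (prev (first v)) ≡ g β (first v) xor x β v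
    g-prev-first β v = trans (g-prev β (first v)) (cong (λ u → g β (first v) xor x β u) (at-first v))

    g-prev-second : ∀ β v → g β (prev (second v)) ≡ g β (second v) xor x β v
    g-prev-second β v = trans (g-prev β (second v)) (cong (λ u → g β (second v) xor x β u) (at-second v))

    -- For colour `D v` the kernel equation at `v` is `I x = x`, so the difference computed by
    -- `across` vanishes.
    joins-parallel : ∀ v → g (D v) (first v) ≡ g (D v) (second v)
                         × g (D v) (prev (first v)) ≡ g (D v) (prev (second v))
    joins-parallel v = eq , trans (g-prev-first (D v) v) (trans (cong (_xor x (D v) v) eq) (sym (g-prev-second (D v) v)))
      where
      eq : g (D v) (first v) ≡ g (D v) (second v)
      eq = xor≡false⇒≡ (trans (across (D v) v) (trans
        (cong (x (D v) v xor_) (trans (kernel (D v) v) (cong (λ k → not k ∧ x (D v) v) (xor-same (D v)))))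
        (xor-same (x (D v) v))))

    -- For the other colour `I x` vanishes at `v`, so the outgoing values differ by `x`, just as an
    -- outgoing value differs from the incoming one of the same visit.
    joins-crosswise : ∀ v → g (not (D v)) (first v) ≡ g (not (D v)) (prev (second v))
                          × g (not (D v)) (prev (first v)) ≡ g (not (D v)) (second v)
    joins-crosswise v = trans (solve-first (g β (first v)) (g β (second v)) (x β v) diff) (sym (g-prev-second β v))
                      , trans (g-prev-first β v) (solve-second (g β (first v)) (g β (second v)) (x β v) diff)
      where
      β : Bool
      β = not (D v)

      diff : g β (first v) xor g β (second v) ≡ x β v
      diff = trans (across β v) (trans
        (cong (x β v xor_) (trans (kernel β v) (cong (λ k → not k ∧ x β v) (xor-inverseˡ (D v)))))
        (xor-identityʳ (x β v)))

      solve-first : ∀ p q y → p xor q ≡ y → p ≡ q xor y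
      solve-first p q _ refl = solve 2 (λ p q → p := q :+ (p :+ q)) refl p q

      solve-second : ∀ p q y → p xor q ≡ y → p xor y ≡ q
      solve-second p q _ refl = solve 2 (λ p q → p :+ (p :+ q) := q) refl p q

    φ : Flag n → Bool
    φ (d , s) = g (col (d , s)) (edge d)

    φ-turn : ∀ d → φ (corner (d , true)) ≡ φ (d , true)
    φ-turn d = trans (cong (λ β → g β (edge (turn d))) (trans (col-corner (d , true)) (not-involutive (c d))))
      (trans (go d) (cong (λ β → g β (edge d)) (sym (not-involutive (c d)))))
      where
      go : ∀ d → g (c d) (edge (turn d)) ≡ g (c d) (edge d)
      -- In rotation order the corners join out to out, second out to first in, in to in, and second
      -- in to first out.
      go (v , 0F) = sym (proj₁ (joins-parallel v))
      go (v , 1F) = proj₂ (joins-crosswise v)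
      go (v , 2F) = sym (proj₂ (joins-parallel v))
      go (v , 3F) = proj₁ (joins-crosswise v)

    φ-invariant : Invariant φ
    φ-invariant = φ-corner , λ (d , s) → cong₂ g (col-alongEdge (d , s)) (edge-otherEnd d)
      where
      φ-corner : ∀ f → φ (corner f) ≡ φ f
      φ-corner (d , true)        = φ-turn d
      φ-corner ((v , k) , false) = trans (sym (φ-turn (v , prev k))) (cong φ (corner-involutive rotation ((v , k) , false)))

    -- First link of the chain recovering `g`, then `x`, then `z` from `φ`; it makes distinct data
    -- give distinct invariant functions.
    φ-determines-g : ∀ β i → φ (w i , not (β xor c (w i))) ≡ g β i
    φ-determines-g β i = cong₂ g (col-surjective β (w i)) (cong proj₁ (slot-w i))

    g-determines-x : ∀ β v → g β (prev (first v)) xor g β (first v) ≡ x β v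
    g-determines-x β v = trans (cong (_xor g β (first v)) (g-prev-first β v))
      (solve 2 (λ p y → (p :+ y) :+ p := y) refl (g β (first v)) (x β v))

    x-determines-z : x true ⊕ x false ≗ z
    x-determines-z v = solve 2 (λ p y → (p :+ y) :+ p := y) refl (M z v) (z v)

  module _ (rank : ∀ y z → N y z ≡ degree y ∧ degree z) where

    private
      -- `n + 1` coordinates: two for the constants of the two colours and `n′` for the vectors
      -- orthogonal to `degree`.
      Cube : Set
      Cube = Fin (2 ℕ.+ n′) → Bool

      embed : (Fin n′ → Bool) → Fin n → Bool
      embed = proj₁ (hyperplane degree)

      bit : Cube → Bool → Bool
      bit t true  = t 0F
      bit t false = t 1F

      vec : Cube → Fin n → Bool
      vec t = embed λ i → t (suc (suc i))

      vec-even : ∀ t → ∑[ v < n ] (degree v ∧ vec t v) ≡ false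
      vec-even t = proj₁ (proj₂ (hyperplane degree)) λ i → t (suc (suc i))

      module At (t : Cube) = KernelVector rank (bit t) (vec t) (vec-even t)

      φ-injective : ∀ {s t} → At.φ s ≗ At.φ t → s ≗ t
      φ-injective {s} {t} eq = λ where
          0F            → bits true
          1F            → bits false
          (suc (suc i)) → proj₂ (proj₂ (hyperplane degree)) vecs i
        where
        module S = At s
        module T = At t

        gs : ∀ β i → S.g β i ≡ T.g β i
        gs β i = trans (sym (S.φ-determines-g β i)) (trans (eq (w i , not (β xor c (w i)))) (T.φ-determines-g β i))

        bits : ∀ β → bit s β ≡ bit t β
        bits β = trans (sym (S.g-last β)) (trans (gs β (fromℕ _)) (T.g-last β))

        xs : ∀ β v → S.x β v ≡ T.x β v
        xs β v = trans (sym (S.g-determines-x β v))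
          (trans (cong₂ _xor_ (gs β (prev (first v))) (gs β (first v))) (T.g-determines-x β v))

        vecs : vec s ≗ vec t
        vecs v = trans (sym (S.x-determines-z v))
          (trans (cong₂ _xor_ (xs true v) (xs false v)) (T.x-determines-z v))

    -- An invariant function is determined by its values on one flag per face, so the `2 ^ (n + 1)`
    -- functions built from `Cube` need more than `n` faces.
    n<faces : n ℕ.< faces
    n<faces = cube-injection⇒≤ (λ t → At.φ t ∘ representative) λ {s} {t} eq → φ-injective λ f →
      trans (sym (on-representative (At.φ-invariant s) f))
            (trans (eq (face f)) (on-representative (At.φ-invariant t) f))

    realizable : RealizableWithin (+ 1) X
    realizable = H , Equivalence.from (connectivity≤1⇔ n m faces) (begin
        suc m              ≡⟨ cong (λ k → suc (n ℕ.+ k)) (ℕₚ.+-identityʳ n) ⟩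
        suc (n ℕ.+ n)      ≡⟨ ℕₚ.+-suc n n ⟨
        n ℕ.+ suc n        ≤⟨ ℕₚ.+-monoʳ-≤ n n<faces ⟩
        n ℕ.+ faces        ∎) , twoColourable , spells
      where open ℕₚ.≤-Reasoning

theorem3p1 : (n : ℕ) .{{_ : NonZero n}} (X : GaussCode n) →
    RealizableWithin (+ 1) X ⇔
    (Σ[ colour ∈ (Fin n → Bool) ]
    (∀ (y z : Fin n) →
    Odd (interlaceCount X y z) ⇔
    (Interlaced X y z × colour y ≡ colour z)))
theorem3p1 zero {{n≢0}} X = contradiction refl (ℕ.≢-nonZero⁻¹ 0 {{n≢0}})
theorem3p1 (suc n′) X = mk⇔
  (λ (H , connectivity≤1 , coloured , spells) →
    let open Necessity X H coloured spells in
    -- A symbol is coloured like the corner at its vertex between the two outgoing edge-ends.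
    diagonal , rank-one⇒coloured diagonal λ y z →
      trans (rank-one-diagonal connectivity≤1 y z)
            (cong₂ _∧_ (N-diagonal diagonal y) (N-diagonal diagonal z)))
  (λ (colour , coloured) → Sufficiency.realizable X colour (coloured⇒rank-one colour coloured))
  where open Criterion X
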